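{- For every constant $\delta>0$ and every constant integer $k\ge 2$, there exists a sufficiently large constant $C=C(k,\delta)$ such that every undirected unweighted graph $G=(V,E)$ on $n$ vertices admits a subgraph $H\subseteq G$ with $O\big(n^{1+\frac{1+\delta}{2^{k+1}-1}}\big)$ edges such that for every pair $s,t\in V$, $$\mathrm{dist}_H(s,t)\le \mathrm{dist}_G(s,t)+C\cdot \mathrm{dist}_G(s,t)^{1-1/k}.$$
   Context: Graphs are finite and simple. $\mathrm{dist}_G(s,t)$ denotes the shortest-path distance (number of edges) between $s$ and $t$ in $G$, equal to $\infty$ if they are not connected (in which case the required inequality is vacuous). The subgraph $H$ has the same vertex set $V$ as $G$ (it is a spanner of $G$ with stretch function $f(d)=d+C\cdot d^{1-1/k}$). Since $k$ and $\delta$ are constants, the constant hidden in $O(\cdot)$ may depend on $k$ and $\delta$, but not on $G$ or $n$. -}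

module Defs where

open import Data.Fin.Base as Fin using (Fin)
import Data.Fin.Properties as Fin
open import Data.Integer.Base using (+_; -[1+_])
open import Data.List.Base using (List; length; filter; cartesianProduct; allFin)
open import Data.Nat.Base as ℕ using (ℕ; suc; _≤_; _∸_; _^_; NonZero)
import Data.Nat.Properties as ℕ
open import Data.Product.Base using (∃; _×_; _,_)
open import Data.Rational.Unnormalised.Base as ℚ
  using (ℚᵘ; mkℚᵘ; 1ℚᵘ; _≃_; _<_)
import Data.Rational.Unnormalised.Properties as ℚ
open import Data.Sum.Base using (_⊎_)
open import Function.Bundles using (_⇔_; mk⇔; Equivalence)
open import Level using (0ℓ)
open import Relation.Binary.Construct.Closure.ReflexiveTransitive using (Star; fold)
open import Relation.Binary.Core using (Rel; _⇒_)
open import Relation.Binary.Definitions using (Symmetric; Decidable)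
open import Relation.Binary.PropositionalEquality using (_≡_)
open import Relation.Nullary using (¬_)
open import Relation.Nullary.Decidable using (_×-dec_)

------------------------------------------------------------------------
-- Dedekind reals

-- Lower q and Upper q say that q < x and x < q respectively.

record ℝ : Set₁ where
  field
    Lower Upper     : ℚᵘ → Set
    lower-inhabited : ∃ Lower
    upper-inhabited : ∃ Upper
    lower-rounded   : ∀ q → Lower q ⇔ (∃ λ r → q < r × Lower r)
    upper-rounded   : ∀ q → Upper q ⇔ (∃ λ r → r < q × Upper r)
    disjoint        : ∀ q → ¬ (Lower q × Upper q)
    located         : ∀ {q r} → q < r → Lower q ⊎ Upper r

open ℝ public

infix 4 _<ᴿ_ _ᴿ<_

_<ᴿ_ : ℚᵘ → ℝ → Set
q <ᴿ x = Lower x q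

_ᴿ<_ : ℝ → ℚᵘ → Set
x ᴿ< q = Upper x q

-- The image of a cut under an increasing bijection g of the rationals is
-- its preimage under the inverse f of g.

record IncreasingBijection : Set where
  field
    f g    : ℚᵘ → ℚᵘ
    f-mono : ∀ {p q} → p < q → f p < f q
    g-mono : ∀ {p q} → p < q → g p < g q
    fg     : ∀ q → f (g q) ≃ q
    gf     : ∀ q → g (f q) ≃ q

image : IncreasingBijection → ℝ → ℝ
image φ x = record
  { Lower           = λ q → Lower x (f q)
  ; Upper           = λ q → Upper x (f q)
  ; lower-inhabited = let (q , l) = lower-inhabited x in g q , resp-lower q l
  ; upper-inhabited = let (q , u) = upper-inhabited x in g q , resp-upper q u
  ; lower-rounded   = λ q → mk⇔
      (λ l → let (r , fq<r , l′) = to (lower-rounded x (f q)) l in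
             g r , ℚ.<-respˡ-≃ (gf q) (g-mono fq<r) , resp-lower r l′)
      (λ (r , q<r , l) → from (lower-rounded x (f q)) (f r , f-mono q<r , l))
  ; upper-rounded   = λ q → mk⇔
      (λ u → let (r , r<fq , u′) = to (upper-rounded x (f q)) u in
             g r , ℚ.<-respʳ-≃ (gf q) (g-mono r<fq) , resp-upper r u′)
      (λ (r , r<q , u) → from (upper-rounded x (f q)) (f r , f-mono r<q , u))
  ; disjoint        = λ q → disjoint x (f q)
  ; located         = λ q<r → located x (f-mono q<r)
  }
  where
  open IncreasingBijection φ
  open Equivalence using (to; from)

  resp-lower : ∀ q → Lower x q → Lower x (f (g q))
  resp-lower q l = let (r , q<r , l′) = to (lower-rounded x q) l in
    from (lower-rounded x (f (g q))) (r , ℚ.<-respˡ-≃ (ℚ.≃-sym (fg q)) q<r , l′)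

  resp-upper : ∀ q → Upper x q → Upper x (f (g q))
  resp-upper q u = let (r , r<q , u′) = to (upper-rounded x q) u in
    from (upper-rounded x (f (g q))) (r , ℚ.<-respʳ-≃ (ℚ.≃-sym (fg q)) r<q , u′)

translation : ℚᵘ → IncreasingBijection
translation p = record
  { f      = ℚ._- p
  ; g      = ℚ._+ p
  ; f-mono = ℚ.+-monoˡ-< (ℚ.- p)
  ; g-mono = ℚ.+-monoˡ-< p
  ; fg     = λ q → ℚ.≃-trans (ℚ.+-assoc q p (ℚ.- p))
      (ℚ.≃-trans (ℚ.+-congʳ q (ℚ.+-inverseʳ p)) (ℚ.+-identityʳ q))
  ; gf     = λ q → ℚ.≃-trans (ℚ.+-assoc q (ℚ.- p) p)
      (ℚ.≃-trans (ℚ.+-congʳ q (ℚ.+-inverseˡ p)) (ℚ.+-identityʳ q))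
  }

division : (m : ℕ) .{{_ : NonZero m}} → IncreasingBijection
division m@(suc m-1) = record
  { f      = ℚ._* M
  ; g      = ℚ._* (ℚ.1/ M)
  ; f-mono = ℚ.*-monoˡ-<-pos M
  ; g-mono = ℚ.*-monoˡ-<-pos (ℚ.1/ M)
  ; fg     = λ q → ℚ.≃-trans (ℚ.*-assoc q (ℚ.1/ M) M)
      (ℚ.≃-trans (ℚ.*-congˡ {q} (ℚ.*-inverseˡ M)) (ℚ.*-identityʳ q))
  ; gf     = λ q → ℚ.≃-trans (ℚ.*-assoc q M (ℚ.1/ M))
      (ℚ.≃-trans (ℚ.*-congˡ {q} (ℚ.*-inverseʳ M)) (ℚ.*-identityʳ q))
  }
  where
  M : ℚᵘ
  M = (+ m) ℚ./ 1

infixr 6 _+ᴿ_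
infixl 7 _/ᴿ_

_+ᴿ_ : ℚᵘ → ℝ → ℝ
p +ᴿ x = image (translation p) x

_/ᴿ_ : ℝ → (m : ℕ) .{{_ : NonZero m}} → ℝ
x /ᴿ m = image (division m) x

------------------------------------------------------------------------
-- Comparison with fractional powers

infix 4 _≤[_·_^ℚ_] _≤[_·_^ℝ_] _≤_+[_·_^ℚ_]

-- a ≤ c · b ^ (p / q), with both sides raised to the q-th power.  For a
-- negative exponent the power of b is moved to the left, so b should then
-- be nonzero.

_≤[_·_^ℚ_] : ℕ → ℕ → ℕ → ℚᵘ → Set
a ≤[ c · b ^ℚ mkℚᵘ (+ p)    q-1 ] = a ^ suc q-1 ≤ c ^ suc q-1 ℕ.* b ^ p
a ≤[ c · b ^ℚ mkℚᵘ -[1+ p ] q-1 ] = a ^ suc q-1 ℕ.* b ^ suc p ≤ c ^ suc q-1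

-- For b ≥ 1, b ^ x is the infimum of b ^ q over rationals q > x.  This is
-- also right for b = 0 when x > 0, both sides being 0.

_≤[_·_^ℝ_] : ℕ → ℕ → ℕ → ℝ → Set
a ≤[ c · b ^ℝ x ] = ∀ q → x ᴿ< q → a ≤[ c · b ^ℚ q ]

-- a ≤ d + c · b ^ x.  The second summand is nonnegative, so d may be moved
-- to the left with truncated subtraction.

_≤_+[_·_^ℚ_] : ℕ → ℕ → ℕ → ℕ → ℚᵘ → Set
a ≤ d +[ c · b ^ℚ x ] = (a ∸ d) ≤[ c · b ^ℚ x ]

------------------------------------------------------------------------
-- Finite simple graphs

record Graph (n : ℕ) : Set₁ where
  field
    Adj        : Rel (Fin n) 0ℓ
    Adj-sym    : Symmetric Adj
    Adj-irrefl : ∀ v → ¬ Adj v v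
    Adj?       : Decidable Adj

open Graph public

infix 4 _⊆_

-- Spanning subgraphs: H and G have the same vertex set.

_⊆_ : ∀ {n} → Graph n → Graph n → Set
H ⊆ G = Adj H ⇒ Adj G

-- Each edge is listed once, with its smaller endpoint first.

edges : ∀ {n} → Graph n → List (Fin n × Fin n)
edges {n} G =
  filter (λ (u , v) → (u Fin.<? v) ×-dec Adj? G u v)
         (cartesianProduct (allFin n) (allFin n))

∣E_∣ : ∀ {n} → Graph n → ℕ
∣E G ∣ = length (edges G)

Walk : ∀ {n} → Graph n → Fin n → Fin n → Set
Walk G = Star (Adj G)

∣_∣ʷ : ∀ {n} {G : Graph n} {s t} → Walk G s t → ℕ
∣ w ∣ʷ = fold (λ _ _ → ℕ) (λ _ → suc) 0 w

-- Dist G s t d says that dist_G(s,t) is finite and equal to d.  The distance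
-- is ∞ exactly when there is no such d.

Dist : ∀ {n} → Graph n → Fin n → Fin n → ℕ → Set
Dist G s t d = (∃ λ (w : Walk G s t) → ∣_∣ʷ {G = G} w ≡ d)
             × (∀ (w : Walk G s t) → d ≤ ∣_∣ʷ {G = G} w)

------------------------------------------------------------------------
-- The exponent of the size bound

2^[1+k]∸1-nonZero : ∀ k → NonZero (2 ^ suc k ∸ 1)
2^[1+k]∸1-nonZero k =
  ℕ.>-nonZero (ℕ.m<n⇒0<n∸m (ℕ.+-mono-≤ (ℕ.m^n>0 2 k)
    (ℕ.≤-trans (ℕ.m^n>0 2 k) (ℕ.m≤m+n (2 ^ k) 0))))

1+[1+_]/[2^[1+_]∸1] : ℝ → ℕ → ℝ
1+[1+ δ ]/[2^[1+ k ]∸1] = 1ℚᵘ +ᴿ (1ℚᵘ +ᴿ δ) /ᴿ (2 ^ suc k ∸ 1)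
  where instance _ = 2^[1+k]∸1-nonZero k

{-# OPTIONS --safe #-}
module Submission where

-- Fix a scale r.  By induction on k, with R = r^k and θ = σ^(2^(k+1)), two
-- kinds of subgraphs preserve distances up to r^(k+1) in an n-vertex region
-- with additive error O(R), up to a factor ν^O(1) where ν ≈ n^(1/κ):
--
-- * p demand pairs are served with nσ(1 + p/θ²) edges;
-- * if n ≤ σ^(2^(k+2) − 1), all pairs are served with nσ edges.
--
-- Cover the region by clusters of radius O(R) and total size about νn such
-- that every R-ball lies in one of them.  A geodesic becomes a chain of at most
-- r pieces of length at most R, each inside a cluster.  By the pairwise
-- statement at level k, buying a piece in a cluster of size m costs mσ/θ edges
-- on average and error O(r^(k-1)), hence O(R) along the chain, once every
-- cluster pays for its own share mσ and a spanning tree.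
--
-- Let S be a set of clusters.  The part of a geodesic between its first and its
-- last piece in S is bought unless, for some cluster y on it, chains already
-- bought join both its end clusters to y; in that case the detour through y has
-- error O(R).  Each purchase makes a new member of S joined to y, so at most
-- |S| bought chains visit y, and the cost is O(nσ|S|/θ).  For all pairs, S
-- consists of the clusters larger than σ^(2^(k+1) − 1), of which there are
-- O(νθ), and smaller clusters are handled recursively.  For p pairs, S is a
-- hitting set of θ clusters outside which the prefixes and suffixes of the p
-- chains are cheap enough to be bought.
--
-- Finally r runs through the powers of two, and σ is about the (2^(k+2) − 1)-th
-- root of the number of vertices of the whole graph.

open import Defs
open import Data.Bool.Base using (Bool; true; false; if_then_else_; T; _∨_)
open import Data.Bool.Properties using (T?; T-∨)
open import Data.Empty using (⊥)
open import Data.Fin.Base using (Fin; zero; suc; toℕ)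
import Data.Fin.Properties as Fin
open import Data.Integer.Base as ℤ using (ℤ; -[1+_])
import Data.Integer.Properties as ℤ
import Data.Integer.Tactic.RingSolver as ℤ-Solver
open import Data.List.Base using (List; []; _∷_; _++_; length; map; filter; concatMap; allFin; tabulate; reverse; take; takeWhile; dropWhile; cartesianProduct; upTo; lookup)
import Data.List.Properties as List
import Data.List.Membership.DecPropositional as DecMembership
open import Data.List.Membership.Propositional using (_∈_; find; lose)
open import Data.List.Membership.Propositional.Properties
open import Data.List.Relation.Binary.Subset.Propositional using () renaming (_⊆_ to _⊆ᴸ_)
open import Data.List.Relation.Unary.All as All using (All; []; _∷_; all?)
open import Data.List.Relation.Unary.All.Properties using (¬All⇒Any¬; all-takeWhile)
open import Data.List.Relation.Unary.Any as Any using (Any; here; there; any?)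
import Data.List.Relation.Unary.Any.Properties as Any
open import Data.List.Relation.Unary.Unique.Propositional using (Unique; []; _∷_)
import Data.List.Relation.Unary.Unique.Propositional.Properties as Unique
open import Data.Nat using (ℕ; _≤_; NonZero)
open import Data.Nat.Base using (zero; suc; _+_; _*_; _∸_; _^_; _<_; z≤n; s≤s; >-nonZero; >-nonZero⁻¹)
open import Data.Nat.Properties
open import Data.Nat.Tactic.RingSolver using (solve-∀)
open import Data.Product using (∃; _×_)
open import Data.Product.Base using (_,_; proj₁; proj₂; swap)
open import Data.Product.Properties using (≡-dec)
open import Data.Rational.Unnormalised using (0ℚᵘ; 1ℚᵘ; _-_; _/_)
open import Data.Rational.Unnormalised.Base as ℚ using (mkℚᵘ; *<*)
import Data.Rational.Unnormalised.Properties as ℚ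
open import Data.Sum.Base using (_⊎_; inj₁; inj₂; [_,_])
open import Data.Unit.Base using (tt)
open import Function.Base using (_∘_; id)
open import Function.Bundles using (Equivalence)
open import Relation.Binary.Construct.Closure.ReflexiveTransitive using (ε; _◅_)
open import Relation.Binary.PropositionalEquality hiding ([_])
open import Relation.Nullary using (¬_; Dec; yes; no; does; contradiction)
open import Relation.Nullary.Decidable using (¬?; _×-dec_; _⊎-dec_; map′; ⌊_⌋; toWitness; fromWitness)

private variable
  A B : Set

-- Finite sums

∑ : (A → ℕ) → List A → ℕ
∑ f []       = 0
∑ f (x ∷ xs) = f x + ∑ f xs

∑-mono : {f g : A → ℕ} → (∀ x → f x ≤ g x) → ∀ xs → ∑ f xs ≤ ∑ g xs
∑-mono f≤g []       = z≤n
∑-mono f≤g (x ∷ xs) = +-mono-≤ (f≤g x) (∑-mono f≤g xs)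

∑-mono-∈ : {f g : A → ℕ} → ∀ xs → (∀ {x} → x ∈ xs → f x ≤ g x) → ∑ f xs ≤ ∑ g xs
∑-mono-∈ []       f≤g = z≤n
∑-mono-∈ (x ∷ xs) f≤g = +-mono-≤ (f≤g (here refl)) (∑-mono-∈ xs (λ i → f≤g (there i)))

∑-cong : {f g : A → ℕ} → (∀ x → f x ≡ g x) → ∀ xs → ∑ f xs ≡ ∑ g xs
∑-cong f≡g []       = refl
∑-cong f≡g (x ∷ xs) = cong₂ _+_ (f≡g x) (∑-cong f≡g xs)

∑-const : ∀ c (xs : List A) → ∑ (λ _ → c) xs ≡ length xs * c
∑-const c []       = refl
∑-const c (x ∷ xs) = cong (c +_) (∑-const c xs)

∑-+ : ∀ (f g : A → ℕ) xs → ∑ (λ x → f x + g x) xs ≡ ∑ f xs + ∑ g xs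
∑-+ f g []       = refl
∑-+ f g (x ∷ xs) = trans (cong (f x + g x +_) (∑-+ f g xs)) (eq (f x) (g x) _ _)
  where
  eq : ∀ a b c d → a + b + (c + d) ≡ a + c + (b + d)
  eq = solve-∀

∑-*ˡ : ∀ c (f : A → ℕ) xs → ∑ (λ x → c * f x) xs ≡ c * ∑ f xs
∑-*ˡ c f []       = sym (*-zeroʳ c)
∑-*ˡ c f (x ∷ xs) = trans (cong (c * f x +_) (∑-*ˡ c f xs)) (sym (*-distribˡ-+ c (f x) _))

∑-*ʳ : ∀ c (f : A → ℕ) xs → ∑ (λ x → f x * c) xs ≡ ∑ f xs * c
∑-*ʳ c f xs = trans (∑-cong (λ x → *-comm (f x) c) xs) (trans (∑-*ˡ c f xs) (*-comm c _))

∑-++ : ∀ (f : A → ℕ) xs ys → ∑ f (xs ++ ys) ≡ ∑ f xs + ∑ f ys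
∑-++ f []       ys = refl
∑-++ f (x ∷ xs) ys = trans (cong (f x +_) (∑-++ f xs ys)) (sym (+-assoc (f x) _ _))

∑-map : ∀ (f : B → ℕ) (g : A → B) xs → ∑ f (map g xs) ≡ ∑ (f ∘ g) xs
∑-map f g []       = refl
∑-map f g (x ∷ xs) = cong (f (g x) +_) (∑-map f g xs)

∑-concatMap : ∀ (f : B → ℕ) (g : A → List B) xs → ∑ f (concatMap g xs) ≡ ∑ (∑ f ∘ g) xs
∑-concatMap f g []       = refl
∑-concatMap f g (x ∷ xs) = trans (∑-++ f (g x) _) (cong (∑ f (g x) +_) (∑-concatMap f g xs))

∑-reverse : ∀ (f : A → ℕ) xs → ∑ f (reverse xs) ≡ ∑ f xs
∑-reverse f []       = refl
∑-reverse f (x ∷ xs) = begin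
  ∑ f (reverse (x ∷ xs))        ≡⟨ cong (∑ f) (List.unfold-reverse x xs) ⟩
  ∑ f (reverse xs ++ x ∷ [])    ≡⟨ ∑-++ f (reverse xs) _ ⟩
  ∑ f (reverse xs) + (f x + 0)  ≡⟨ cong₂ _+_ (∑-reverse f xs) (+-identityʳ (f x)) ⟩
  ∑ f xs + f x                  ≡⟨ +-comm (∑ f xs) (f x) ⟩
  f x + ∑ f xs                  ∎
  where open ≡-Reasoning

∑-comm : ∀ (f : A → B → ℕ) xs ys →
         ∑ (λ x → ∑ (f x) ys) xs ≡ ∑ (λ y → ∑ (λ x → f x y) xs) ys
∑-comm f []       ys = sym (trans (∑-const 0 ys) (*-zeroʳ (length ys)))
∑-comm f (x ∷ xs) ys = trans (cong (∑ (f x) ys +_) (∑-comm f xs ys)) (sym (∑-+ (f x) _ ys))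

length≡∑ : (xs : List A) → length xs ≡ ∑ (λ _ → 1) xs
length≡∑ xs = sym (trans (∑-const 1 xs) (*-identityʳ _))

length-concatMap : (g : A → List B) → ∀ xs → length (concatMap g xs) ≡ ∑ (length ∘ g) xs
length-concatMap g []       = refl
length-concatMap g (x ∷ xs) = trans (List.length-++ (g x)) (cong (length (g x) +_) (length-concatMap g xs))

⟦_⟧ : {P : Set} → Dec P → ℕ
⟦ d ⟧ = if does d then 1 else 0

∑-allFin-suc : ∀ {K} (f : Fin (suc K) → ℕ) → ∑ f (allFin (suc K)) ≡ f zero + ∑ (f ∘ suc) (allFin K)
∑-allFin-suc {K} f = cong (f zero +_) (trans
  (cong (∑ f) (sym (List.map-tabulate id suc)))
  (∑-map f suc (allFin K)))

∑-pick : ∀ {K} (f : Fin K → ℕ) y → ∑ (λ x → ⟦ y Fin.≟ x ⟧ * f x) (allFin K) ≡ f y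
∑-pick {suc K} f zero    = trans (∑-allFin-suc (λ x → ⟦ zero Fin.≟ x ⟧ * f x)) (trans
  (cong₂ _+_ (*-identityˡ (f zero)) (trans (∑-const 0 (allFin K)) (*-zeroʳ (length (allFin K)))))
  (+-identityʳ (f zero)))
∑-pick {suc K} f (suc y) = trans (∑-allFin-suc (λ x → ⟦ suc y Fin.≟ x ⟧ * f x)) (∑-pick (f ∘ suc) y)

2ab≤a²+b² : ∀ a b → 2 * (a * b) ≤ a * a + b * b
2ab≤a²+b² a b with ≤-total a b
... | inj₁ a≤b with d , refl ← m≤n⇒∃[o]m+o≡n a≤b = subst (2 * (a * (a + d)) ≤_) (eq a d) (m≤m+n _ (d * d))
  where
  eq : ∀ a d → 2 * (a * (a + d)) + d * d ≡ a * a + (a + d) * (a + d)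
  eq = solve-∀
... | inj₂ b≤a with d , refl ← m≤n⇒∃[o]m+o≡n b≤a = subst (2 * ((b + d) * b) ≤_) (eq b d) (m≤m+n _ (d * d))
  where
  eq : ∀ b d → 2 * ((b + d) * b) + d * d ≡ (b + d) * (b + d) + b * b
  eq = solve-∀

-- Cauchy–Schwarz, by summing 2X(pw) ≤ (pw)² + X² over the values w of f.
∑²≤length*∑² : ∀ (f : A → ℕ) xs → ∑ f xs * ∑ f xs ≤ length xs * ∑ (λ x → f x * f x) xs
∑²≤length*∑² f []          = z≤n
∑²≤length*∑² f xs@(_ ∷ _) = go (length xs) refl (∑ f xs) refl
  where
  open ≤-Reasoning
  e₁ : ∀ p X → p * (X * X) + p * (X * X) ≡ (2 * X * p) * X
  e₁ = solve-∀
  e₂ : ∀ X p a → 2 * X * p * a ≡ 2 * (p * a * X)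
  e₂ = solve-∀
  e₃ : ∀ p a X → p * a * (p * a) + X * X ≡ p * p * (a * a) + X * X
  e₃ = solve-∀
  Q = ∑ (λ x → f x * f x) xs

  go : ∀ p → p ≡ length xs → ∀ X → X ≡ ∑ f xs → X * X ≤ p * Q
  go p@(suc _) p≡ X X≡ = *-cancelˡ-≤ p (+-cancelʳ-≤ (p * (X * X)) _ _ (begin
    p * (X * X) + p * (X * X)                 ≡⟨ e₁ p X ⟩
    (2 * X * p) * X                           ≡⟨ cong ((2 * X * p) *_) X≡ ⟩
    (2 * X * p) * ∑ f xs                      ≡⟨ sym (∑-*ˡ (2 * X * p) f xs) ⟩
    ∑ (λ x → 2 * X * p * f x) xs              ≤⟨ ∑-mono (λ x → ≤-trans (≤-reflexive (e₂ X p (f x))) (≤-trans (2ab≤a²+b² (p * f x) X) (≤-reflexive (e₃ p (f x) X)))) xs ⟩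
    ∑ (λ x → p * p * (f x * f x) + X * X) xs  ≡⟨ ∑-+ (λ x → p * p * (f x * f x)) (λ _ → X * X) xs ⟩
    ∑ (λ x → p * p * (f x * f x)) xs + ∑ (λ _ → X * X) xs
      ≡⟨ cong₂ _+_ (trans (∑-*ˡ (p * p) (λ x → f x * f x) xs) (*-assoc p p Q))
                   (trans (∑-const (X * X) xs) (cong (_* (X * X)) (sym p≡))) ⟩
    p * (p * Q) + p * (X * X)                 ∎))

-- Hitting sets of small prefix weight

-- The left side is the diagonal of the expanded product on the right.
∑-*-≤ : ∀ (f g : A → ℕ) xs → ∑ (λ x → f x * g x) xs ≤ ∑ f xs * ∑ g xs
∑-*-≤ f g []       = z≤n
∑-*-≤ f g (x ∷ xs) = begin
  f x * g x + ∑ (λ x → f x * g x) xs  ≤⟨ +-monoʳ-≤ (f x * g x) (∑-*-≤ f g xs) ⟩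
  f x * g x + ∑ f xs * ∑ g xs         ≤⟨ m≤m+n _ (f x * ∑ g xs + ∑ f xs * g x) ⟩
  f x * g x + ∑ f xs * ∑ g xs + (f x * ∑ g xs + ∑ f xs * g x) ≡⟨ eq (f x) (g x) _ _ ⟩
  (f x + ∑ f xs) * (g x + ∑ g xs)     ∎
  where
  open ≤-Reasoning
  eq : ∀ a b c d → a * b + c * d + (a * d + c * b) ≡ (a + c) * (b + d)
  eq = solve-∀

-- If `c * t * f x < V` held for every `x`, multiplying the last hypothesis by `t` and bounding term
-- by term would give `t * V ≤ t * (V - 1)`.
weighted-pigeonhole : ∀ {K} (m f : Fin K → ℕ) c t V → 0 < V → ∑ m (allFin K) ≤ t →
  V ≤ c * ∑ (λ x → m x * f x) (allFin K) → ∃ λ x → V ≤ c * t * f x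
-- Nothing can be cancelled when `t` is 0; instead all weights vanish, so the sum is 0 and `V`
-- cannot be positive.
weighted-pigeonhole {K} m f c zero V 0<V ∑m≤0 V≤ =
  contradiction (≤-trans 0<V V≤) (≤⇒≯ (begin
    c * ∑ (λ x → m x * f x) (allFin K)          ≤⟨ *-monoʳ-≤ c (∑-*-≤ m f (allFin K)) ⟩
    c * (∑ m (allFin K) * ∑ f (allFin K))       ≤⟨ *-monoʳ-≤ c (*-monoˡ-≤ (∑ f (allFin K)) ∑m≤0) ⟩
    c * 0                                       ≡⟨ *-zeroʳ c ⟩
    0                                           ∎))
  where open ≤-Reasoning
weighted-pigeonhole {K} m f c t@(suc _) (suc V) 0<V ∑m≤t V≤ with Fin.any? (λ x → suc V ≤? c * t * f x)
... | yes p = p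
... | no ¬p = contradiction (*-cancelˡ-≤ {suc V} {V} t (begin
  t * suc V                                     ≤⟨ *-monoʳ-≤ t V≤ ⟩
  t * (c * ∑ (λ x → m x * f x) (allFin K))      ≡⟨ sym (trans (∑-*ˡ (t * c) _ (allFin K)) (*-assoc t c _)) ⟩
  ∑ (λ x → t * c * (m x * f x)) (allFin K)      ≤⟨ ∑-mono (λ x → ≤-trans (≤-reflexive (eq t c (m x) (f x)))
                                                      (*-monoʳ-≤ (m x) (≤-pred (≰⇒> (λ q → ¬p (x , q)))))) (allFin K) ⟩
  ∑ (λ x → m x * V) (allFin K)                  ≡⟨ ∑-*ʳ V m (allFin K) ⟩
  ∑ m (allFin K) * V                            ≤⟨ *-monoˡ-≤ V ∑m≤t ⟩
  t * V                                         ∎)) 1+n≰n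
  where
  open ≤-Reasoning
  eq : ∀ t c a b → t * c * (a * b) ≡ a * (c * t * b)
  eq = solve-∀

-- In the application `P` consists of pieces of geodesics, `lab` names the cluster of a piece, and
-- `m` is the size of a cluster.
module Weighted {P : Set} {K : ℕ} (lab : P → Fin K) (m : Fin K → ℕ) where

  infix 4 _∈?_
  _∈?_ : ∀ x S → Dec (x ∈ S)
  _∈?_ = DecMembership._∈?_ (Fin._≟_ {K})

  wt : List P → ℕ
  wt = ∑ (m ∘ lab)

  occ : Fin K → List P → ℕ
  occ x = ∑ (λ p → ⟦ lab p Fin.≟ x ⟧)

  ∑-occ : ∀ ps → ∑ (λ x → m x * occ x ps) (allFin K) ≡ wt ps
  ∑-occ ps = begin
    ∑ (λ x → m x * occ x ps) (allFin K)
      ≡⟨ ∑-cong (λ x → trans (*-comm (m x) (occ x ps)) (sym (∑-*ʳ (m x) _ ps))) (allFin K) ⟩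
    ∑ (λ x → ∑ (λ p → ⟦ lab p Fin.≟ x ⟧ * m x) ps) (allFin K)
      ≡⟨ ∑-comm _ (allFin K) ps ⟩
    ∑ (λ p → ∑ (λ x → ⟦ lab p Fin.≟ x ⟧ * m x) (allFin K)) ps
      ≡⟨ ∑-cong (λ p → ∑-pick m (lab p)) ps ⟩
    wt ps ∎
    where open ≡-Reasoning

  avoid? : ∀ S p → Dec (¬ (lab p ∈ S))
  avoid? S p = ¬? (lab p ∈? S)

  -- `cut S` is the part of a list before its first label from `S`. `after x` starts at the first
  -- occurrence of `x`, so it is what such a prefix loses when `x` joins `S`.
  cut : List (Fin K) → List P → List P
  cut S = takeWhile (avoid? S)

  after : Fin K → List P → List P
  after x = dropWhile (avoid? (x ∷ []))

  cut-∷ : ∀ x S ps → cut (x ∷ S) ps ≡ cut (x ∷ []) (cut S ps)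
  cut-∷ x S []       = refl
  cut-∷ x S (p ∷ ps) with does (lab p ∈? S)
  ... | true with does (lab p Fin.≟ x)
  ...   | true  = refl
  ...   | false = refl
  cut-∷ x S (p ∷ ps) | false with does (lab p Fin.≟ x)
  ...   | true  = refl
  ...   | false = cong (p ∷_) (cut-∷ x S ps)

  wt-cut-after : ∀ x ps → wt (cut (x ∷ []) ps) + wt (after x ps) ≡ wt ps
  wt-cut-after x ps = trans (sym (∑-++ (m ∘ lab) (cut (x ∷ []) ps) _))
                            (cong wt (List.takeWhile++dropWhile (avoid? (x ∷ [])) ps))

  wt-after-≤ : ∀ x ps → wt (after x ps) ≤ wt ps
  wt-after-≤ x ps = ≤-trans (m≤n+m _ (wt (cut (x ∷ []) ps))) (≤-reflexive (wt-cut-after x ps))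

  ∑-cut-≤ : ∀ (f : P → ℕ) S ps → ∑ f (cut S ps) ≤ ∑ f ps
  ∑-cut-≤ f S ps = ≤-trans (m≤m+n _ (∑ f (dropWhile (avoid? S) ps)))
    (≤-reflexive (trans (sym (∑-++ f (cut S ps) _)) (cong (∑ f) (List.takeWhile++dropWhile (avoid? S) ps))))

  ∑-cut-++ : ∀ (f : P → ℕ) S ps qs → ∑ f (cut S ps) ≤ ∑ f (cut S (ps ++ qs))
  ∑-cut-++ f S []       qs = z≤n
  ∑-cut-++ f S (p ∷ ps) qs with does (lab p ∈? S)
  ... | true  = z≤n
  ... | false = +-monoʳ-≤ (f p) (∑-cut-++ f S ps qs)

  -- The square is at most twice the sum over positions of the weight there times the weight of the
  -- suffix starting there. That suffix lies inside `after x` for the label `x` of the position;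
  -- grouping positions by label gives the right side.
  wt²≤ : ∀ ps → wt ps * wt ps ≤ 2 * ∑ (λ x → m x * (occ x ps * wt (after x ps))) (allFin K)
  wt²≤ []       = z≤n
  wt²≤ (p ∷ ps) = begin
    (a + w) * (a + w)                                   ≤⟨ m≤m+n _ (a * a) ⟩
    (a + w) * (a + w) + a * a                           ≡⟨ e₁ a w ⟩
    2 * (a * (a + w)) + w * w                           ≤⟨ +-monoʳ-≤ (2 * (a * (a + w))) (wt²≤ ps) ⟩
    2 * (a * (a + w)) + 2 * ∑ F (allFin K)              ≡⟨ sym (*-distribˡ-+ 2 (a * (a + w)) _) ⟩
    2 * (a * (a + w) + ∑ F (allFin K))                  ≡⟨ cong (λ z → 2 * (z + ∑ F (allFin K))) (sym (∑-pick (λ x → m x * (a + w)) (lab p))) ⟩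
    2 * (∑ E (allFin K) + ∑ F (allFin K))               ≡⟨ cong (2 *_) (sym (∑-+ E F (allFin K))) ⟩
    2 * ∑ (λ x → E x + F x) (allFin K)                  ≤⟨ *-monoʳ-≤ 2 (∑-mono term (allFin K)) ⟩
    2 * ∑ (λ x → m x * (occ x (p ∷ ps) * wt (after x (p ∷ ps)))) (allFin K) ∎
    where
    open ≤-Reasoning
    a = m (lab p)
    w = wt ps
    E F : Fin K → ℕ
    E x = ⟦ lab p Fin.≟ x ⟧ * (m x * (a + w))
    F x = m x * (occ x ps * wt (after x ps))
    e₁ : ∀ a w → (a + w) * (a + w) + a * a ≡ 2 * (a * (a + w)) + w * w
    e₁ = solve-∀
    e₂ : ∀ k o b c → 1 * (k * c) + k * (o * c) ≡ k * ((1 + o) * c)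
    e₂ = solve-∀
    term : ∀ x → E x + F x ≤ m x * (occ x (p ∷ ps) * wt (after x (p ∷ ps)))
    term x with does (lab p Fin.≟ x)
    ... | true  = ≤-trans (+-monoʳ-≤ (1 * (m x * (a + w)))
                    (*-monoʳ-≤ (m x) (*-monoʳ-≤ (occ x ps) (≤-trans (wt-after-≤ x ps) (m≤n+m w a)))))
                    (≤-reflexive (e₂ (m x) (occ x ps) a (a + w)))
    ... | false = ≤-refl

  module _ (μ t : ℕ) (∑m≤t : ∑ m (allFin K) ≤ t) where

    -- Cauchy-Schwarz over the lists of `L`, and `wt²≤` within each list, bound the squared total by
    -- a sum over labels weighted by `m`; the pigeonhole picks a label that does at least as well as
    -- the average.
    heavy-label : ∀ L → (∀ {l} → l ∈ L → ∀ x → occ x l ≤ μ) → 0 < ∑ wt L →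
      ∃ λ x → ∑ wt L * ∑ wt L ≤ length L * (2 * μ) * t * ∑ (wt ∘ after x) L
    heavy-label L occ≤μ 0<X = weighted-pigeonhole m (λ x → ∑ (wt ∘ after x) L) (length L * (2 * μ)) t (X * X)
      (*-mono-< 0<X 0<X) ∑m≤t (begin
      X * X                                                                     ≤⟨ ∑²≤length*∑² wt L ⟩
      length L * ∑ (λ l → wt l * wt l) L                                        ≤⟨ *-monoʳ-≤ (length L) (∑-mono-∈ L (λ {l} l∈L → bound l (occ≤μ l∈L))) ⟩
      length L * ∑ (λ l → 2 * μ * ∑ (λ x → m x * wt (after x l)) (allFin K)) L  ≡⟨ cong (length L *_) (∑-*ˡ (2 * μ) _ L) ⟩
      length L * (2 * μ * ∑ (λ l → ∑ (λ x → m x * wt (after x l)) (allFin K)) L)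
        ≡⟨ sym (*-assoc (length L) (2 * μ) _) ⟩
      length L * (2 * μ) * ∑ (λ l → ∑ (λ x → m x * wt (after x l)) (allFin K)) L
        ≡⟨ cong (length L * (2 * μ) *_) (trans (∑-comm (λ l x → m x * wt (after x l)) L (allFin K))
             (∑-cong (λ x → ∑-*ˡ (m x) (wt ∘ after x) L) (allFin K))) ⟩
      length L * (2 * μ) * ∑ (λ x → m x * ∑ (wt ∘ after x) L) (allFin K)        ∎)
      where
      open ≤-Reasoning
      X = ∑ wt L
      e : ∀ a μ b → a * (μ * b) ≡ μ * (a * b)
      e = solve-∀
      bound : ∀ l → (∀ x → occ x l ≤ μ) → wt l * wt l ≤ 2 * μ * ∑ (λ x → m x * wt (after x l)) (allFin K)
      bound l occ≤ = begin
        wt l * wt l                                                   ≤⟨ wt²≤ l ⟩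
        2 * ∑ (λ x → m x * (occ x l * wt (after x l))) (allFin K)     ≤⟨ *-monoʳ-≤ 2 (∑-mono (λ x → *-monoʳ-≤ (m x) (*-monoˡ-≤ (wt (after x l)) (occ≤ x))) (allFin K)) ⟩
        2 * ∑ (λ x → m x * (μ * wt (after x l))) (allFin K)           ≡⟨ cong (2 *_) (trans (∑-cong (λ x → e (m x) μ (wt (after x l))) (allFin K)) (∑-*ˡ μ _ (allFin K))) ⟩
        2 * (μ * ∑ (λ x → m x * wt (after x l)) (allFin K))           ≡⟨ sym (*-assoc 2 μ _) ⟩
        2 * μ * ∑ (λ x → m x * wt (after x l)) (allFin K)             ∎

    -- Adding a label greedily turns the total weight X of the unhit prefixes
    -- into at most X − X²/Z, so that s labels bring it down to Z/s.
    hitting-set : ∀ L → (∀ {l} → l ∈ L → ∀ x → occ x l ≤ μ) → ∀ s →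
      ∃ λ S → length S ≤ s × s * ∑ (wt ∘ cut S) L ≤ length L * (2 * μ) * t
    hitting-set L occ≤μ zero    = [] , z≤n , z≤n
    hitting-set L occ≤μ (suc s) with hitting-set L occ≤μ s
    ... | S , |S|≤s , sX≤Z with suc s * ∑ (wt ∘ cut S) L ≤? length L * (2 * μ) * t
    ...   | yes ok = S , m≤n⇒m≤1+n |S|≤s , ok
    ...   | no ¬ok = x ∷ S , s≤s |S|≤s , +-cancelʳ-≤ (suc s * D) _ _ (begin
      suc s * ∑ (wt ∘ cut (x ∷ S)) L + suc s * D   ≡⟨ sym (*-distribˡ-+ (suc s) _ D) ⟩
      suc s * (∑ (wt ∘ cut (x ∷ S)) L + D)         ≡⟨ cong (suc s *_) split ⟩
      suc s * X                                    ≡⟨ +-comm X (s * X) ⟩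
      s * X + X                                    ≤⟨ +-mono-≤ sX≤Z X≤D ⟩
      Z + suc s * D                                ∎)
      where
      open ≤-Reasoning
      X Z : ℕ
      X = ∑ (wt ∘ cut S) L
      Z = length L * (2 * μ) * t
      L′ = map (cut S) L
      occ′ : ∀ {l} → l ∈ L′ → ∀ x → occ x l ≤ μ
      occ′ l∈ x with ∈-map⁻ (cut S) l∈
      ... | l₀ , l₀∈L , refl = ≤-trans (∑-cut-≤ _ S l₀) (occ≤μ l₀∈L x)
      0<X : 0 < X
      0<X = n≢0⇒n>0 λ X≡0 → ¬ok (≤-trans (≤-reflexive (trans (cong (suc s *_) X≡0) (*-zeroʳ s))) z≤n)
      found = heavy-label L′ occ′ (≤-trans 0<X (≤-reflexive (sym (∑-map wt (cut S) L))))
      x = proj₁ found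
      D = ∑ (λ l → wt (after x (cut S l))) L
      XX≤ZD : X * X ≤ Z * D
      XX≤ZD = begin
        X * X                                       ≡⟨ cong₂ _*_ (sym (∑-map wt (cut S) L)) (sym (∑-map wt (cut S) L)) ⟩
        ∑ wt L′ * ∑ wt L′                           ≤⟨ proj₂ found ⟩
        length L′ * (2 * μ) * t * ∑ (wt ∘ after x) L′ ≡⟨ cong₂ (λ u v → u * (2 * μ) * t * v) (List.length-map (cut S) L) (∑-map (wt ∘ after x) (cut S) L) ⟩
        Z * D                                       ∎
      e : ∀ s X D → (1 + s) * X * D ≡ X * ((1 + s) * D)
      e = solve-∀
      -- The failed test bounds `Z` by `suc s * X`, which `XX≤ZD` turns into a gain: the new label
      -- removes at least the fraction 1/(s+1) of `X`.
      X≤D : X ≤ suc s * D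
      X≤D = *-cancelˡ-≤ X {{>-nonZero 0<X}} (begin
        X * X              ≤⟨ XX≤ZD ⟩
        Z * D              ≤⟨ *-monoˡ-≤ D (<⇒≤ (≰⇒> ¬ok)) ⟩
        suc s * X * D      ≡⟨ e s X D ⟩
        X * (suc s * D)    ∎)
      split : ∑ (wt ∘ cut (x ∷ S)) L + D ≡ X
      split = trans (sym (∑-+ (wt ∘ cut (x ∷ S)) (λ l → wt (after x (cut S l))) L)) (∑-cong (λ l →
        trans (cong (λ z → wt z + wt (after x (cut S l))) (cut-∷ x S l)) (wt-cut-after x (cut S l))) L)

-- Greedy purchases

length-filter-mono : ∀ {P Q : A → Set} (P? : ∀ x → Dec (P x)) (Q? : ∀ x → Dec (Q x)) → (∀ {x} → P x → Q x) →
                     ∀ xs → length (filter P? xs) ≤ length (filter Q? xs)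
length-filter-mono P? Q? P⇒Q []       = z≤n
length-filter-mono P? Q? P⇒Q (x ∷ xs) with P? x | Q? x
... | yes p | yes q = s≤s (length-filter-mono P? Q? P⇒Q xs)
... | yes p | no ¬q = contradiction (P⇒Q p) ¬q
... | no ¬p | yes q = m≤n⇒m≤1+n (length-filter-mono P? Q? P⇒Q xs)
... | no ¬p | no ¬q = length-filter-mono P? Q? P⇒Q xs

length-filter-strict : ∀ {P Q : A → Set} (P? : ∀ x → Dec (P x)) (Q? : ∀ x → Dec (Q x)) → (∀ {x} → P x → Q x) →
                       ∀ {x xs} → x ∈ xs → ¬ P x → Q x → length (filter P? xs) < length (filter Q? xs)
length-filter-strict P? Q? P⇒Q {xs = x ∷ xs} (here refl) ¬p q with P? x | Q? x
... | yes p | _     = contradiction p ¬p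
... | no _  | yes _ = s≤s (length-filter-mono P? Q? P⇒Q xs)
... | no _  | no ¬q = contradiction q ¬q
length-filter-strict P? Q? P⇒Q {xs = y ∷ xs} (there x∈xs) ¬p q with P? y | Q? y
... | yes p | yes _ = s≤s (length-filter-strict P? Q? P⇒Q x∈xs ¬p q)
... | yes p | no ¬q = contradiction (P⇒Q p) ¬q
... | no _  | yes _ = m≤n⇒m≤1+n (length-filter-strict P? Q? P⇒Q x∈xs ¬p q)
... | no _  | no _  = length-filter-strict P? Q? P⇒Q x∈xs ¬p q

module Greedy {P D : Set} {K : ℕ} (lab : P → Fin K) (m : Fin K → ℕ)
              (body : D → List P) (ends : D → List (Fin K)) where

  open Weighted lab m

  -- A bought item ends in `a` and runs through `y`; its part between the two joins these clusters
  -- in the spanner.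
  Touched : List D → Fin K → Fin K → Set
  Touched B y a = Any (λ d → a ∈ ends d × y ∈ map lab (body d)) B

  touched? : ∀ B y a → Dec (Touched B y a)
  touched? B y a = any? (λ d → (a ∈? ends d) ×-dec (y ∈? map lab (body d))) B

  -- Bought items join one label `y` of `d` to every end of `d`, so a detour through `y` can replace
  -- `d`.
  Bypassed : List D → D → Set
  Bypassed B d = Any (λ y → All (Touched B y) (ends d)) (map lab (body d))

  bypassed? : ∀ B d → Dec (Bypassed B d)
  bypassed? B d = any? (λ y → all? (touched? B y) (ends d)) (map lab (body d))

  occ-∉ : ∀ y ps → ¬ (y ∈ map lab ps) → occ y ps ≡ 0
  occ-∉ y []       y∉ = refl
  occ-∉ y (p ∷ ps) y∉ with lab p Fin.≟ y
  ... | yes refl = contradiction (here refl) y∉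
  ... | no _     = occ-∉ y ps (y∉ ∘ there)

  module _ (μ : ℕ) (S : List (Fin K)) (occ≤μ : ∀ d x → occ x (body d) ≤ μ)
           (ends∈S : ∀ d {a} → a ∈ ends d → a ∈ S) where

    -- An item is bought only if, for every label y on it, one of its ends
    -- becomes newly touched through y; this happens at most length S times.
    greedy-cover : ∀ ds → ∃ λ B → (∀ {d} → d ∈ ds → d ∈ B ⊎ Bypassed B d)
                                × (∀ y → occ y (concatMap body B) ≤ μ * length S)
    greedy-cover ds =
      let B , good , occ≤ = go ds in
      B , good , λ y → ≤-trans (occ≤ y) (*-monoʳ-≤ μ (List.length-filter (touched? B y) S))
      where
      -- The induction counts only the members of `S` already touched through `y`. A purchase
      -- visiting `y` increases this number, which pays for its at most `μ` visits.
      go : ∀ ds → ∃ λ B → (∀ {d} → d ∈ ds → d ∈ B ⊎ Bypassed B d)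
                        × (∀ y → occ y (concatMap body B) ≤ μ * length (filter (touched? B y) S))
      go []       = [] , (λ ()) , λ _ → z≤n
      go (d ∷ ds) with go ds
      ... | B , good , occ≤ with bypassed? B d
      ...   | yes b = B , (λ { (here refl) → inj₂ b ; (there i) → good i }) , occ≤
      ...   | no ¬b = d ∷ B , (λ { (here refl) → inj₁ (here refl) ; (there i) → weaken (good i) }) , occ≤′
        where
        weaken : ∀ {d′} → d′ ∈ B ⊎ Bypassed B d′ → d′ ∈ d ∷ B ⊎ Bypassed (d ∷ B) d′
        weaken (inj₁ i) = inj₁ (there i)
        weaken (inj₂ b) = inj₂ (Any.map (All.map there) b)

        occ≤′ : ∀ y → occ y (concatMap body (d ∷ B)) ≤ μ * length (filter (touched? (d ∷ B) y) S)
        occ≤′ y = ≤-trans (≤-reflexive (∑-++ (λ p → ⟦ lab p Fin.≟ y ⟧) (body d) (concatMap body B)))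
                          (bound (y ∈? map lab (body d)))
          where
          open ≤-Reasoning
          new old : ℕ
          old = length (filter (touched? B y) S)
          new = length (filter (touched? (d ∷ B) y) S)
          bound : Dec (y ∈ map lab (body d)) → occ y (body d) + occ y (concatMap body B) ≤ μ * new
          bound (no y∉) = begin
            occ y (body d) + occ y (concatMap body B)  ≡⟨ cong (_+ _) (occ-∉ y (body d) y∉) ⟩
            occ y (concatMap body B)                   ≤⟨ occ≤ y ⟩
            μ * old                                    ≤⟨ *-monoʳ-≤ μ (length-filter-mono (touched? B y) (touched? (d ∷ B) y) there S) ⟩
            μ * new                                    ∎
          bound (yes y∈) with find (¬All⇒Any¬ (touched? B y) (ends d) (λ all → ¬b (lose y∈ all)))
          ... | a , a∈ , ¬t = begin
            occ y (body d) + occ y (concatMap body B)  ≤⟨ +-mono-≤ (occ≤μ d y) (occ≤ y) ⟩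
            μ + μ * old                                ≡⟨ sym (*-suc μ old) ⟩
            μ * suc old                                ≤⟨ *-monoʳ-≤ μ (length-filter-strict (touched? B y) (touched? (d ∷ B) y)
                                                            there (ends∈S d a∈) ¬t (here (a∈ , y∈))) ⟩
            μ * new                                    ∎

-- Walks, regions and sparse covers

data Within {V : Set} (E : V → V → Set) : V → V → ℕ → Set where
  here : ∀ {u n} → Within E u u n
  step : ∀ {u w v n} → E u w → Within E w v n → Within E u v (suc n)

module _ {V : Set} {E : V → V → Set} where

  weaken : ∀ {u v m n} → m ≤ n → Within E u v m → Within E u v n
  weaken m≤n       here       = here
  weaken (s≤s m≤n) (step e p) = step e (weaken m≤n p)

  infixr 5 _⁀_
  _⁀_ : ∀ {u v w m n} → Within E u v m → Within E v w n → Within E u w (m + n)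
  _⁀_ {m = m} {n} here q = weaken (m≤n+m n m) q
  step e p ⁀ q = step e (p ⁀ q)

  flip : (∀ {u v} → E u v → E v u) → ∀ {u v n} → Within E u v n → Within E v u n
  flip E-sym here                   = here
  flip E-sym (step {n = n} e p) = subst (Within E _ _) (+-comm n 1) (flip E-sym p ⁀ step (E-sym e) here)

  -- If the walk stops before using up the budget `a`, its endpoint serves as the midpoint.
  split : ∀ {u v} a {b} → Within E u v (a + b) → ∃ λ w → Within E u w a × Within E w v b
  split zero    p          = _ , here , p
  split (suc a) here       = _ , here , here
  split (suc a) (step e p) = let w , q , r = split a p in w , step e q , r

  within-0 : ∀ {u v} → Within E u v 0 → u ≡ v
  within-0 here = refl

  Geo : V → V → ℕ → Set
  Geo u v ℓ = Within E u v ℓ × (∀ {n} → Within E u v n → ℓ ≤ n)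

  geo-unique : ∀ {u v a b} → Geo u v a → Geo u v b → a ≡ b
  geo-unique (p , p-min) (q , q-min) = ≤-antisym (p-min q) (q-min p)

  -- A shorter walk to the midpoint, followed by the remaining part, would shorten the whole
  -- geodesic.
  geo-prefix : ∀ {u v w a b} → Geo u v (a + b) → Within E u w a → Within E w v b → Geo u w a
  geo-prefix {a = a} {b} (_ , min) p q = p , λ p′ → +-cancelʳ-≤ b a _ (min (p′ ⁀ q))

  geo-suffix : ∀ {u v w a b} → Geo u v (a + b) → Within E u w a → Within E w v b → Geo w v b
  geo-suffix {a = a} {b} (_ , min) p q = q , λ q′ → +-cancelˡ-≤ a b _ (min (p ⁀ q′))

  geo-flip : (∀ {u v} → E u v → E v u) → ∀ {u v ℓ} → Geo u v ℓ → Geo v u ℓ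
  geo-flip E-sym (p , min) = flip E-sym p , λ q → min (flip E-sym q)

  geodesic : (∀ u v n → Dec (Within E u v n)) → ∀ {u v n} → Within E u v n → ∃ λ ℓ → ℓ ≤ n × Geo u v ℓ
  geodesic within? {n = zero}  p = 0 , z≤n , p , λ _ → z≤n
  geodesic within? {u} {v} {suc n} p with within? u v n
  ... | yes q = let ℓ , ℓ≤n , g = geodesic within? q in ℓ , m≤n⇒m≤1+n ℓ≤n , g
  ... | no ¬q = suc n , ≤-refl , p , λ q → ≰⇒> (λ m≤n → ¬q (weaken m≤n q))

within-map : ∀ {V : Set} {E F : V → V → Set} → (∀ {u v} → E u v → F u v) →
             ∀ {u v n} → Within E u v n → Within F u v n
within-map f here       = here
within-map f (step e p) = step (f e) (within-map f p)

within-dec : ∀ {N} {E : Fin N → Fin N → Set} → (∀ u v → Dec (E u v)) → ∀ u v n → Dec (Within E u v n)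
within-dec E? u v zero    = map′ (λ { refl → here }) within-0 (u Fin.≟ v)
within-dec {E = E} E? u v (suc n) = map′ to from ((u Fin.≟ v) ⊎-dec Fin.any? (λ w → E? u w ×-dec within-dec E? w v n))
  where
  to : u ≡ v ⊎ (∃ λ w → E u w × Within E w v n) → Within E u v (suc n)
  to (inj₁ refl)        = here
  to (inj₂ (w , e , p)) = step e p
  from : Within E u v (suc n) → u ≡ v ⊎ (∃ λ w → E u w × Within E w v n)
  from here       = inj₁ refl
  from (step e p) = inj₂ (_ , e , p)

∑-lookup : ∀ (f : A → ℕ) xs → ∑ (f ∘ lookup xs) (allFin (length xs)) ≡ ∑ f xs
∑-lookup f xs = begin
  ∑ (f ∘ lookup xs) (allFin (length xs))      ≡⟨ sym (∑-map f (lookup xs) (allFin (length xs))) ⟩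
  ∑ f (map (lookup xs) (allFin (length xs)))  ≡⟨ cong (∑ f) (List.map-tabulate id (lookup xs)) ⟩
  ∑ f (tabulate (lookup xs))                  ≡⟨ cong (∑ f) (List.tabulate-lookup xs) ⟩
  ∑ f xs                                      ∎
  where open ≡-Reasoning

module Regions {N : ℕ} (G : Graph N) where

  V : Set
  V = Fin N

  Region : Set
  Region = V → Bool

  Inside : Region → V → V → Set
  Inside A u v = T (A u) × T (A v) × Adj G u v

  inside-sym : ∀ A {u v} → Inside A u v → Inside A v u
  inside-sym A (u∈ , v∈ , e) = v∈ , u∈ , Adj-sym G e

  within? : ∀ A u v n → Dec (Within (Inside A) u v n)
  within? A = within-dec (λ u v → T? (A u) ×-dec T? (A v) ×-dec Adj? G u v)

  within-∈ : ∀ {A u v n} → T (A u) → Within (Inside A) u v n → T (A v)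
  within-∈ u∈ here                  = u∈
  within-∈ _  (step (_ , w∈ , _) p) = within-∈ w∈ p

  members : Region → List V
  members A = filter (T? ∘ A) (allFin N)

  size : Region → ℕ
  size A = length (members A)

  ∈-members : ∀ {A v} → T (A v) → v ∈ members A
  ∈-members {A} {v} v∈ = ∈-filter⁺ (T? ∘ A) (∈-allFin v) v∈

  size-mono : ∀ {A B} → (∀ {v} → T (A v) → T (B v)) → size A ≤ size B
  size-mono {A} {B} A⊆B = length-filter-mono (T? ∘ A) (T? ∘ B) A⊆B (allFin N)

  size-pos : ∀ {A v} → T (A v) → 0 < size A
  size-pos {A} {v} v∈ = ≤-<-trans z≤n
    (length-filter-strict {P = λ _ → ⊥} (λ _ → no id) (T? ∘ A) (λ ()) (∈-allFin v) id v∈)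

  size-disjoint : ∀ A B → (∀ v → T (A v) → T (B v) → ⊥) → size A + size B ≤ size (λ v → A v ∨ B v)
  size-disjoint A B disj = go (allFin N)
    where
    go : ∀ vs → length (filter (T? ∘ A) vs) + length (filter (T? ∘ B) vs) ≤ length (filter (T? ∘ (λ v → A v ∨ B v)) vs)
    go []       = z≤n
    go (v ∷ vs) with A v in a | B v in b
    ... | true  | true  = contradiction (subst T (sym b) _) (disj v (subst T (sym a) _))
    ... | true  | false = s≤s (go vs)
    ... | false | true  = ≤-trans (≤-reflexive (+-suc _ _)) (s≤s (go vs))
    ... | false | false = go vs

  ball : Region → V → ℕ → Region
  ball A c ρ v = ⌊ within? A c v ρ ⌋

  ball⁺ : ∀ {A c ρ v} → Within (Inside A) c v ρ → T (ball A c ρ v)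
  ball⁺ {A} {c} {ρ} {v} = fromWitness {a? = within? A c v ρ}

  ball⁻ : ∀ {A c ρ v} → T (ball A c ρ v) → Within (Inside A) c v ρ
  ball⁻ {A} {c} {ρ} {v} = toWitness {a? = within? A c v ρ}

  -- A sparse neighbourhood cover. Clusters may overlap; `total` counts a vertex once for every
  -- cluster that contains it.
  record Cover (A : Region) (R K t : ℕ) : Set where
    field
      num     : ℕ
      center  : Fin num → V
      radius  : Fin num → ℕ
      center∈ : ∀ x → T (A (center x))
      radius≤ : ∀ x → radius x ≤ K * R

    cluster : Fin num → Region
    cluster x = ball A (center x) (radius x)

    field
      home  : ∀ {v} → T (A v) → ∃ λ x → ∀ {z} → Within (Inside A) v z R → T (cluster x z)
      total : ∑ (size ∘ cluster) (allFin num) ≤ t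

  module _ (κ ν : ℕ) .{{_ : NonZero ν}} (N≤ν^κ : N ≤ ν ^ κ) (A : Region) (R : ℕ) where

    private
      -- The radii (2^j - 1)·R. If the balls of radius `ρ j` about `u` and `v` meet, the ball of
      -- radius `ρ j + ρ j + R` about `u` contains the whole `R`-ball of `v`; this is the halo of
      -- `u`.
      ρ : ℕ → ℕ
      ρ zero    = 0
      ρ (suc j) = ρ j + (ρ j + R)

      ρ+R≤ : ∀ j → ρ j + R ≤ 2 ^ j * R
      ρ+R≤ zero    = ≤-reflexive (sym (*-identityˡ R))
      ρ+R≤ (suc j) = begin
        ρ j + (ρ j + R) + R          ≡⟨ e (ρ j) R ⟩
        2 * (ρ j + R)                ≤⟨ *-monoʳ-≤ 2 (ρ+R≤ j) ⟩
        2 * (2 ^ j * R)              ≡⟨ sym (*-assoc 2 (2 ^ j) R) ⟩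
        2 ^ suc j * R                ∎
        where
        open ≤-Reasoning
        e : ∀ a b → a + (a + b) + b ≡ 2 * (a + b)
        e = solve-∀

      core halo : ℕ → V → Region
      core j v = ball A v (ρ j)
      halo j v = ball A v (ρ (suc j))

      Slow : ℕ → V → Set
      Slow j v = size (halo j v) ≤ ν * size (core j v)

      slow? : ∀ j v → Dec (Slow j v)
      slow? j v = size (halo j v) ≤? ν * size (core j v)

      -- The halo of a level is the core of the next one, so a level that is not slow multiplies the
      -- size of the core by more than `ν`.
      growth : ∀ v i → (∃ λ j → j < i × Slow j v) ⊎ ν ^ i ≤ size (core i v)
      growth v zero = inj₂ (size-pos {core 0 v} {v} (ball⁺ here))
      growth v (suc i) with growth v i
      ... | inj₁ (j , j<i , slow) = inj₁ (j , m≤n⇒m≤1+n j<i , slow)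
      ... | inj₂ large with slow? i v
      ...   | yes slow = inj₁ (i , ≤-refl , slow)
      ...   | no ¬slow = inj₂ (≤-trans (*-monoʳ-≤ ν large) (<⇒≤ (≰⇒> ¬slow)))

      size≤N : ∀ B → size B ≤ N
      size≤N B = ≤-trans (List.length-filter (T? ∘ B) (allFin N)) (≤-reflexive (List.length-tabulate {n = N} id))

      -- If no level below `κ` is slow, the core at level `κ` already has at least `ν ^ κ ≥ N`
      -- vertices, and no halo has more than `N`.
      slow-level : ∀ v → ∃ λ j → j < suc κ × Slow j v
      slow-level v with growth v κ
      ... | inj₁ (j , j<κ , slow) = j , m≤n⇒m≤1+n j<κ , slow
      ... | inj₂ large = κ , ≤-refl , (begin
        size (halo κ v)      ≤⟨ size≤N (halo κ v) ⟩
        N                    ≤⟨ N≤ν^κ ⟩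
        ν ^ κ                ≤⟨ large ⟩
        size (core κ v)      ≤⟨ m≤n*m _ ν ⟩
        ν * size (core κ v)  ∎)
        where open ≤-Reasoning

      -- A maximal family of disjoint slowly growing cores: enlarging them to halos
      -- covers all slow vertices, at the price of a factor ν in size.
      packing : ∀ j vs (U : Region) → (∀ {v} → T (U v) → T (A v)) →
        ∃ λ us → ∑ (size ∘ core j) us + size U ≤ size A
               × (∀ {u} → u ∈ us → T (A u) × Slow j u)
               × (∀ {v} → v ∈ vs → T (A v) → Slow j v →
                    ∃ λ z → Within (Inside A) v z (ρ j) × (T (U z) ⊎ ∃ λ u → u ∈ us × Within (Inside A) u z (ρ j)))
      packing j [] U U⊆A = [] , size-mono {U} {A} U⊆A , (λ ()) , λ ()
      packing j (v ∷ vs) U U⊆A with T? (A v) ×-dec slow? j v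
      ... | no ¬ok with packing j vs U U⊆A
      ...   | us , ∑≤ , us-ok , covered = us , ∑≤ , us-ok ,
              λ { (here refl) v∈ slow → contradiction (v∈ , slow) ¬ok ; (there i) → covered i }
      -- `U` is the union of the cores chosen so far, and `v` is chosen just when its core avoids
      -- `U`. Since `U` is empty at the start, the common vertex `z` finally lies in the core of a
      -- chosen centre.
      packing j (v ∷ vs) U U⊆A | yes (v∈A , slow) with Fin.any? (λ z → T? (core j v z) ×-dec T? (U z))
      ...   | yes (z , z∈ , z∈U) with packing j vs U U⊆A
      ...     | us , ∑≤ , us-ok , covered = us , ∑≤ , us-ok ,
                λ { (here refl) _ _ → z , ball⁻ z∈ , inj₁ z∈U ; (there i) → covered i }
      packing j (v ∷ vs) U U⊆A | yes (v∈A , slow) | no disj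
            with packing j vs (λ z → U z ∨ core j v z)
                   (λ {z} t → [ U⊆A , (λ c → within-∈ v∈A (ball⁻ c)) ] (Equivalence.to (T-∨ {U z}) t))
      ...     | us , ∑≤ , us-ok , covered = v ∷ us , ∑≤′ , us-ok′ , covered′
        where
        open ≤-Reasoning
        e : ∀ a b c → a + b + c ≡ b + (c + a)
        e = solve-∀
        ∑≤′ : size (core j v) + ∑ (size ∘ core j) us + size U ≤ size A
        ∑≤′ = begin
          size (core j v) + ∑ (size ∘ core j) us + size U   ≡⟨ e (size (core j v)) _ _ ⟩
          ∑ (size ∘ core j) us + (size U + size (core j v)) ≤⟨ +-monoʳ-≤ (∑ (size ∘ core j) us)
                                                                 (size-disjoint U (core j v) (λ z z∈U z∈ → disj (z , z∈ , z∈U))) ⟩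
          ∑ (size ∘ core j) us + size (λ z → U z ∨ core j v z) ≤⟨ ∑≤ ⟩
          size A                                            ∎
        us-ok′ : ∀ {u} → u ∈ v ∷ us → T (A u) × Slow j u
        us-ok′ (here refl) = v∈A , slow
        us-ok′ (there i)   = us-ok i
        covered′ : ∀ {v′} → v′ ∈ v ∷ vs → T (A v′) → Slow j v′ →
          ∃ λ z → Within (Inside A) v′ z (ρ j) × (T (U z) ⊎ ∃ λ u → u ∈ v ∷ us × Within (Inside A) u z (ρ j))
        covered′ (here refl) _ _ = v , here , inj₂ (v , here refl , here)
        covered′ (there i) v′∈ slow′ with covered i v′∈ slow′
        ... | z , p , inj₂ (u , u∈ , q) = z , p , inj₂ (u , there u∈ , q)
        ... | z , p , inj₁ t with Equivalence.to (T-∨ {U z}) t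
        ...   | inj₁ z∈U = z , p , inj₁ z∈U
        ...   | inj₂ z∈  = z , p , inj₂ (v , here refl , ball⁻ z∈)

      packing₀ : ∀ j → _
      packing₀ j = packing j (allFin N) (λ _ → false) (λ ())

      centers : ℕ → List V
      centers j = proj₁ (packing₀ j)

      indices : List (V × ℕ)
      indices = concatMap (λ j → map (_, j) (centers j)) (upTo (suc κ))

      indices⁺ : ∀ {u j} → j < suc κ → u ∈ centers j → (u , j) ∈ indices
      indices⁺ {u} {j} j≤κ u∈ = ∈-concatMap⁺ _ (lose (∈-upTo⁺ j≤κ) (∈-map⁺ (_, j) u∈))

      indices⁻ : ∀ {u j} → (u , j) ∈ indices → j < suc κ × u ∈ centers j
      indices⁻ {u} {j} i with find (∈-concatMap⁻ (λ j → map (_, j) (centers j)) {xs = upTo (suc κ)} i)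
      ... | j′ , j′∈ , i′ with ∈-map⁻ (_, j′) i′
      ...   | _ , u∈ , refl = ∈-upTo⁻ j′∈ , u∈

      index-of : ∀ {u j} → j < suc κ → u ∈ centers j → ∃ λ x → lookup indices x ≡ (u , j)
      index-of j≤κ u∈ = let i = indices⁺ j≤κ u∈ in Any.index i , sym (Any.lookup-index i)

    -- The clusters are the halos of the packings at levels 0 to `κ`. Disjoint cores and slow growth
    -- bound each level by `ν * size A`, and a vertex has its home at a level where it is slow.
    cover : Cover A R (2 ^ suc κ) (suc κ * (ν * size A))
    cover = record
      { num     = length indices
      ; center  = λ x → proj₁ (lookup indices x)
      ; radius  = λ x → ρ (suc (proj₂ (lookup indices x)))
      ; center∈ = λ x → proj₁ (proj₁ (proj₂ (proj₂ (packing₀ _))) (proj₂ (indices⁻ (∈-lookup x))))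
      ; radius≤ = λ x → ≤-trans (m≤m+n _ R) (≤-trans (ρ+R≤ (suc (proj₂ (lookup indices x))))
                    (*-monoˡ-≤ R (^-monoʳ-≤ 2 (proj₁ (indices⁻ (∈-lookup x))))))
      ; home    = home
      ; total   = total
      }
      where
      open ≤-Reasoning

      home : ∀ {v} → T (A v) → ∃ λ x → ∀ {z} → Within (Inside A) v z R →
             T (ball A (proj₁ (lookup indices x)) (ρ (suc (proj₂ (lookup indices x)))) z)
      home {v} v∈ with slow-level v
      ... | j , j≤κ , slow with proj₂ (proj₂ (proj₂ (packing₀ j))) (∈-allFin v) v∈ slow
      ...   | y , p , inj₂ (u , u∈ , q) with index-of j≤κ u∈
      ...     | x , eq = x , λ {z} r → subst (λ c → T (ball A (proj₁ c) (ρ (suc (proj₂ c))) z)) (sym eq)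
                                          (ball⁺ (q ⁀ flip (inside-sym A) p ⁀ r))

      total : ∑ (λ x → size (ball A (proj₁ (lookup indices x)) (ρ (suc (proj₂ (lookup indices x)))))) (allFin (length indices))
              ≤ suc κ * (ν * size A)
      total = begin
        _                                                           ≡⟨ ∑-lookup (λ c → size (halo (proj₂ c) (proj₁ c))) indices ⟩
        ∑ (λ c → size (halo (proj₂ c) (proj₁ c))) indices           ≡⟨ ∑-concatMap _ (λ j → map (_, j) (centers j)) (upTo (suc κ)) ⟩
        ∑ (λ j → ∑ (λ c → size (halo (proj₂ c) (proj₁ c))) (map (_, j) (centers j))) (upTo (suc κ))
                                                                    ≤⟨ ∑-mono level (upTo (suc κ)) ⟩
        ∑ (λ _ → ν * size A) (upTo (suc κ))                         ≡⟨ ∑-const (ν * size A) (upTo (suc κ)) ⟩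
        length (upTo (suc κ)) * (ν * size A)                        ≡⟨ cong (_* (ν * size A)) (List.length-upTo (suc κ)) ⟩
        suc κ * (ν * size A)                                        ∎
        where
        level : ∀ j → ∑ (λ c → size (halo (proj₂ c) (proj₁ c))) (map (_, j) (centers j)) ≤ ν * size A
        level j = begin
          _                                   ≡⟨ ∑-map _ (_, j) (centers j) ⟩
          ∑ (size ∘ halo j) (centers j)       ≤⟨ ∑-mono-∈ (centers j) (λ u∈ → proj₂ (proj₁ (proj₂ (proj₂ (packing₀ j))) u∈)) ⟩
          ∑ (λ u → ν * size (core j u)) (centers j) ≡⟨ ∑-*ˡ ν _ (centers j) ⟩
          ν * ∑ (size ∘ core j) (centers j)   ≤⟨ *-monoʳ-≤ ν (≤-trans (m≤m+n _ _) (proj₁ (proj₂ (packing₀ j)))) ⟩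
          ν * size A                          ∎

-- Chains of pieces

length-filter≡∑ : ∀ {P : A → Set} (P? : ∀ x → Dec (P x)) xs → length (filter P? xs) ≡ ∑ (λ x → ⟦ P? x ⟧) xs
length-filter≡∑ P? [] = refl
length-filter≡∑ P? (x ∷ xs) with does (P? x)
... | true  = cong suc (length-filter≡∑ P? xs)
... | false = length-filter≡∑ P? xs

module Spanners {N : ℕ} (G : Graph N) where

  open Regions G public

  GeoIn : Region → V → V → ℕ → Set
  GeoIn A = Geo {E = Inside A}

  -- Only those listed pairs that are adjacent in `G` count, in either orientation. Subgraphs can
  -- thus be given by arbitrary lists, joined by concatenation and measured by length.
  Span : List (V × V) → V → V → Set
  Span H u v = Adj G u v × ((u , v) ∈ H ⊎ (v , u) ∈ H)

  span-sym : ∀ H {u v} → Span H u v → Span H v u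
  span-sym H (e , inj₁ i) = Adj-sym G e , inj₂ i
  span-sym H (e , inj₂ i) = Adj-sym G e , inj₁ i

  span-mono : ∀ {H H′} → (∀ {e} → e ∈ H → e ∈ H′) → ∀ {u v n} → Within (Span H) u v n → Within (Span H′) u v n
  span-mono H⊆H′ = within-map λ { (e , inj₁ i) → e , inj₁ (H⊆H′ i) ; (e , inj₂ i) → e , inj₂ (H⊆H′ i) }

  restrict : ∀ {A C u v n} → (∀ {z} → Within (Inside A) u z n → T (C z)) →
             Within (Inside A) u v n → Within (Inside C) u v n
  restrict near here                      = here
  restrict near (step e@(_ , _ , adj) p) = step (near here , near (step e here) , adj) (restrict (near ∘ step e) p)

  module Covered {A : Region} {R K t : ℕ} .{{_ : NonZero R}} (cov : Cover A R K t) where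

    open Cover cov public

    Label : Set
    Label = Fin num

    Piece : Set
    Piece = Label × V × V

    lab : Piece → Label
    lab = proj₁

    weight : Label → ℕ
    weight = size ∘ cluster

    open Weighted lab weight public

    -- A walk of A cut into pieces of length R, only the last one being shorter.
    data Chain : V → List Piece → V → ℕ → Set where
      []   : ∀ {u} → Chain u [] u 0
      cons : ∀ {x u w v ps a b} → (∀ {z} → Within (Inside A) u z R → T (cluster x z)) →
             Within (Inside A) u w a → a ≤ R → a ≡ R ⊎ ps ≡ [] → Chain w ps v b →
             Chain u ((x , u , w) ∷ ps) v (a + b)

    chain-within : ∀ {u ps v ℓ} → Chain u ps v ℓ → Within (Inside A) u v ℓ
    chain-within []               = here
    chain-within (cons _ p _ _ c) = p ⁀ chain-within c

    chain-split : ∀ ps {qs u v ℓ} → Chain u (ps ++ qs) v ℓ →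
      ∃ λ w → ∃ λ a → ∃ λ b → Chain u ps w a × Chain w qs v b × a + b ≡ ℓ
    chain-split []       c = _ , 0 , _ , [] , c , refl
    chain-split (p ∷ ps) (cons {a = a₀} near q a≤R full c) with chain-split ps c
    ... | w , a , b , c₁ , c₂ , refl = w , a₀ + a , b , cons near q a≤R (shrink full) c₁ , c₂ , +-assoc a₀ a b
      where
      shrink : ∀ {qs} → a₀ ≡ R ⊎ ps ++ qs ≡ [] → a₀ ≡ R ⊎ ps ≡ []
      shrink (inj₁ eq) = inj₁ eq
      shrink (inj₂ eq) = inj₂ (List.++-conicalˡ ps _ eq)

    diam : ℕ
    diam = K * R + K * R

    cluster-diam : ∀ {x u v} → T (cluster x u) → T (cluster x v) → Within (Inside A) u v diam
    cluster-diam {x} u∈ v∈ = flip (inside-sym A) (weaken (radius≤ x) (ball⁻ u∈)) ⁀ weaken (radius≤ x) (ball⁻ v∈)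

    -- Every piece that precedes another has full length `R`, so the start `z` of the last piece in
    -- cluster `x` lies at least one `R` further along for each earlier occurrence.
    last-occurrence : ∀ x {u ps v ℓ} → Chain u ps v ℓ → 0 < occ x ps →
      ∃ λ z → ∃ λ a → ∃ λ b → Within (Inside A) u z a × Within (Inside A) z v b × a + b ≡ ℓ
                            × T (cluster x z) × occ x ps * R ≤ a + R
    last-occurrence x (cons {y} {u} {ps = ps} {a} {b} near p a≤R full c) 0<occ with occ x ps in eq
    ... | suc o with last-occurrence x c (subst (0 <_) (sym eq) (s≤s z≤n))
    ...   | z , a′ , b′ , q , q′ , refl , z∈ , occ≤ = z , a + a′ , b′ , p ⁀ q , q′ , +-assoc a a′ b′ , z∈ , (begin
      (⟦ y Fin.≟ x ⟧ + suc o) * R          ≡⟨ *-distribʳ-+ R ⟦ y Fin.≟ x ⟧ (suc o) ⟩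
      ⟦ y Fin.≟ x ⟧ * R + suc o * R        ≤⟨ +-mono-≤ (indicator≤ (does (y Fin.≟ x))) (subst (λ o → o * R ≤ a′ + R) eq occ≤) ⟩
      R + (a′ + R)                         ≡⟨ sym (+-assoc R a′ R) ⟩
      R + a′ + R                           ≡⟨ cong (λ r → r + a′ + R) (sym (is-full full eq)) ⟩
      a + a′ + R                           ∎)
      where
      open ≤-Reasoning
      indicator≤ : ∀ b → (if b then 1 else 0) * R ≤ R
      indicator≤ true  = ≤-reflexive (*-identityˡ R)
      indicator≤ false = z≤n
      is-full : ∀ {qs} → a ≡ R ⊎ qs ≡ [] → occ x qs ≡ suc o → a ≡ R
      is-full (inj₁ a≡R)  _ = a≡R
      is-full (inj₂ refl) ()
    last-occurrence x (cons {y} {u} {ps = ps} {a} {b} near p a≤R full c) 0<occ | zero with y Fin.≟ x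
    ... | yes refl = u , 0 , a + b , here , p ⁀ chain-within c , refl , near here , ≤-reflexive (*-identityˡ R)
    last-occurrence x (cons _ _ _ _ _) () | zero | no _

    -- The first and the last piece labelled `x` start in the same cluster, at distance at most 2KR.
    -- On a geodesic this leaves room for 2K+1 pieces of length `R`.
    occ≤ : ∀ x {u ps v ℓ} → Chain u ps v ℓ → GeoIn A u v ℓ → occ x ps ≤ suc (K + K)
    occ≤ x [] _ = z≤n
    occ≤ x ch@(cons {y} {ps = ps} near p a≤R full c) g with y Fin.≟ x | last-occurrence x ch
    ... | no _     | _ = occ≤ x c (geo-suffix g p (chain-within c))
    ... | yes refl | last with last (s≤s z≤n)
    ...   | z , d , d′ , q , q′ , eq , z∈ , occ*R≤ = *-cancelʳ-≤ _ _ R (begin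
      suc (occ y ps) * R     ≤⟨ occ*R≤ ⟩
      d + R                  ≤⟨ +-monoˡ-≤ R (proj₂ (geo-prefix (subst (GeoIn A _ _) (sym eq) g) q q′) (cluster-diam (near here) z∈)) ⟩
      K * R + K * R + R      ≡⟨ e K R ⟩
      suc (K + K) * R        ∎)
      where
      open ≤-Reasoning
      e : ∀ K R → K * R + K * R + R ≡ (1 + (K + K)) * R
      e = solve-∀

    chain : ∀ i {u v ℓ} → GeoIn A u v ℓ → ℓ ≤ i * R → ∃ λ ps → length ps ≤ i × Chain u ps v ℓ
    chain zero    (p , _) z≤n with within-0 p
    ... | refl = [] , z≤n , []
    chain (suc i) {ℓ = zero} (p , _) _ with within-0 p
    ... | refl = [] , z≤n , []
    -- A geodesic of positive length cannot be `here`, which also is a walk of length 0. Its first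
    -- step then shows that `u` lies in `A`, as `home` requires.
    chain (suc i) {ℓ = suc ℓ} g@(here , min) ℓ≤ = contradiction (min (here {n = 0})) λ ()
    chain (suc i) {u} {v} {suc ℓ} g@(p@(step (u∈ , _) _) , _) ℓ≤ with suc ℓ ≤? R | home u∈
    ... | yes ℓ≤R | x , near = (x , u , v) ∷ [] , s≤s z≤n ,
                               subst (Chain u _ v) (+-identityʳ (suc ℓ)) (cons near p ℓ≤R (inj₂ refl) [])
    ... | no ℓ≰R  | x , near with m≤n⇒∃[o]m+o≡n (<⇒≤ (≰⇒> ℓ≰R))
    ...   | b , R+b≡ℓ with split R (subst (Within (Inside A) u v) (sym R+b≡ℓ) p) | subst (GeoIn A u v) (sym R+b≡ℓ) g
    ...     | w , q , q′ | g′ with chain i (geo-suffix g′ q q′) (+-cancelˡ-≤ R b _ (subst (_≤ R + i * R) (sym R+b≡ℓ) ℓ≤))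
    ...       | ps , |ps|≤i , c = (x , u , w) ∷ ps , s≤s |ps|≤i ,
                                  subst (Chain u _ v) R+b≡ℓ (cons near q ≤-refl (inj₁ refl) c)

    Served : ℕ → List (V × V) → Piece → Set
    Served e H (x , u , v) = ∀ {ℓ} → GeoIn (cluster x) u v ℓ → ℓ ≤ R → Within (Span H) u v (ℓ + e)

    -- A piece stays in its cluster, which contains the `R`-ball of its start, and it is a geodesic
    -- there because cluster walks are walks of `A`. The errors of the pieces add up.
    chain-served : ∀ {e H u ps v ℓ} → Chain u ps v ℓ → GeoIn A u v ℓ → (∀ {p} → p ∈ ps → Served e H p) →
                   Within (Span H) u v (ℓ + length ps * e)
    chain-served [] _ _ = here
    chain-served {e} {H} (cons {x} {u} {w} {v} {ps} {a} {b} near p a≤R full c) g served =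
      subst (Within (Span H) u v) (eq a e b (length ps * e))
        (served (here refl) (restrict (near ∘ weaken a≤R) p , λ q → proj₂ (geo-prefix g p (chain-within c)) (within-map outside q)) a≤R
          ⁀ chain-served c (geo-suffix g p (chain-within c)) (served ∘ there))
      where
      eq : ∀ a e b q → a + e + (b + q) ≡ a + b + (e + q)
      eq = solve-∀
      outside : ∀ {u v} → Inside (cluster x) u v → Inside A u v
      outside (u∈ , v∈ , adj) = within-∈ (center∈ x) (ball⁻ u∈) , within-∈ (center∈ x) (ball⁻ v∈) , adj

    private
      -- The first edge of a shortest walk from `u` to the centre. The next vertex is strictly
      -- closer, so edges chosen independently, at most one per member, still lead every member to
      -- the centre within the radius.
      tree-edge : Label → V → List (V × V)
      tree-edge x u with within? A u (center x) (radius x)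
      ... | no _  = []
      ... | yes p with geodesic (within? A) p
      ...   | _ , _ , here , _            = []
      ...   | _ , _ , step {w = w} _ _ , _ = (u , w) ∷ []

      length-tree-edge : ∀ x u → length (tree-edge x u) ≤ 1
      length-tree-edge x u with within? A u (center x) (radius x)
      ... | no _  = z≤n
      ... | yes p with geodesic (within? A) p
      ...   | _ , _ , here , _     = z≤n
      ...   | _ , _ , step _ _ , _ = s≤s z≤n

      tree-edge-spec : ∀ x u {n} → Within (Inside A) u (center x) (suc n) → suc n ≤ radius x →
        u ≡ center x ⊎ ∃ λ w → Adj G u w × (u , w) ∈ tree-edge x u × Within (Inside A) w (center x) n
      tree-edge-spec x u {n} p n<r with within? A u (center x) (radius x)
      ... | no ¬p = contradiction (weaken n<r p) ¬p
      ... | yes q with geodesic (within? A) q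
      ...   | _ , _ , here , _                      = inj₁ refl
      ...   | _ , _ , step (_ , _ , adj) q′ , min = inj₂ (_ , adj , here refl , weaken (≤-pred (min p)) q′)

      tree : Label → List (V × V)
      tree x = concatMap (tree-edge x) (members (cluster x))

      length-tree : ∀ x → length (tree x) ≤ weight x
      length-tree x = begin
        length (tree x)                                  ≡⟨ length-concatMap (tree-edge x) (members (cluster x)) ⟩
        ∑ (length ∘ tree-edge x) (members (cluster x))   ≤⟨ ∑-mono (length-tree-edge x) (members (cluster x)) ⟩
        ∑ (λ _ → 1) (members (cluster x))                ≡⟨ sym (length≡∑ (members (cluster x))) ⟩
        weight x                                         ∎
        where open ≤-Reasoning

      tree-reach : ∀ x n {u} → n ≤ radius x → Within (Inside A) u (center x) n → Within (Span (tree x)) u (center x) n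
      tree-reach x zero    n≤r p with within-0 p
      ... | refl = here
      tree-reach x (suc n) {u} n≤r p with tree-edge-spec x u p n≤r
      ... | inj₁ refl = here
      ... | inj₂ (w , adj , i , q) = step
        (adj , inj₁ (∈-concatMap⁺ (tree-edge x) (lose (∈-members {cluster x} (ball⁺ (flip (inside-sym A) (weaken n≤r p)))) i)))
        (tree-reach x n (≤-trans (n≤1+n n) n≤r) q)

      tree-diam : ∀ x {u v} → T (cluster x u) → T (cluster x v) → Within (Span (tree x)) u v diam
      tree-diam x u∈ v∈ = weaken (radius≤ x) (to-center u∈) ⁀ flip (span-sym (tree x)) (weaken (radius≤ x) (to-center v∈))
        where
        to-center : ∀ {u} → T (cluster x u) → Within (Span (tree x)) u (center x) (radius x)
        to-center u∈ = tree-reach x (radius x) ≤-refl (flip (inside-sym A) (ball⁻ u∈))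

    module Buy (c σ θ e : ℕ)
      (pairwise : ∀ B (P : List (V × V)) → ∃ λ H → θ * length H ≤ c * (size B * (σ * (θ + length P)))
         × (∀ {u v ℓ} → (u , v) ∈ P → GeoIn B u v ℓ → ℓ ≤ R → Within (Span H) u v (ℓ + e)))
      where

      -- Each cluster receives its tree and the pairwise subgraph for those pieces of `Q` that carry
      -- its label. The terms linear in the demand add up to `wt Q`, because a label `x` contributes
      -- its weight times `occ x Q`.
      buy : ∀ Q → ∃ λ H → θ * length H ≤ θ * t + c * (σ * (θ * t + wt Q))
                        × (∀ x {u v} → T (cluster x u) → T (cluster x v) → Within (Span H) u v diam)
                        × (∀ {p} → p ∈ Q → Served e H p)
      buy Q = concatMap part labels , cost ,
        (λ x u∈ v∈ → span-mono (part⊆ x ∘ ∈-++⁺ˡ) (tree-diam x u∈ v∈)) ,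
        λ {p} p∈ g ℓ≤R → span-mono (part⊆ (lab p) ∘ ∈-++⁺ʳ (tree (lab p)))
          (proj₂ (proj₂ (sub (lab p))) (∈-map⁺ proj₂ (∈-filter⁺ (λ q → lab q Fin.≟ lab p) p∈ refl)) g ℓ≤R)
        where
        open ≤-Reasoning
        labels : List Label
        labels = allFin num
        demands : Label → List (V × V)
        demands x = map proj₂ (filter (λ p → lab p Fin.≟ x) Q)
        sub : ∀ x → _
        sub x = pairwise (cluster x) (demands x)
        part : Label → List (V × V)
        part x = tree x ++ proj₁ (sub x)
        part⊆ : ∀ x {e} → e ∈ part x → e ∈ concatMap part labels
        part⊆ x i = ∈-concatMap⁺ part (lose (∈-allFin x) i)
        length-demands : ∀ x → length (demands x) ≡ occ x Q
        length-demands x = trans (List.length-map proj₂ (filter (λ p → lab p Fin.≟ x) Q)) (length-filter≡∑ (λ p → lab p Fin.≟ x) Q)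
        eq : ∀ c w σ θ o → c * (w * (σ * (θ + o))) ≡ c * σ * (w * θ + w * o)
        eq = solve-∀
        part-cost : ∀ x → θ * length (part x) ≤ θ * weight x + c * σ * (weight x * θ + weight x * occ x Q)
        part-cost x = begin
          θ * length (part x)                                    ≡⟨ cong (θ *_) (List.length-++ (tree x)) ⟩
          θ * (length (tree x) + length (proj₁ (sub x)))         ≡⟨ *-distribˡ-+ θ (length (tree x)) _ ⟩
          θ * length (tree x) + θ * length (proj₁ (sub x))       ≤⟨ +-mono-≤ (*-monoʳ-≤ θ (length-tree x)) (proj₁ (proj₂ (sub x))) ⟩
          θ * weight x + c * (weight x * (σ * (θ + length (demands x))))
            ≡⟨ cong (λ o → θ * weight x + c * (weight x * (σ * (θ + o)))) (length-demands x) ⟩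
          θ * weight x + c * (weight x * (σ * (θ + occ x Q)))    ≡⟨ cong (θ * weight x +_) (eq c (weight x) σ θ (occ x Q)) ⟩
          θ * weight x + c * σ * (weight x * θ + weight x * occ x Q) ∎
        eq₂ : ∀ c σ θ s w → θ * s + c * σ * (s * θ + w) ≡ θ * s + c * (σ * (θ * s + w))
        eq₂ = solve-∀
        cost : θ * length (concatMap part labels) ≤ θ * t + c * (σ * (θ * t + wt Q))
        cost = begin
          θ * length (concatMap part labels)                     ≡⟨ cong (θ *_) (length-concatMap part labels) ⟩
          θ * ∑ (length ∘ part) labels                           ≡⟨ sym (∑-*ˡ θ (length ∘ part) labels) ⟩
          ∑ (λ x → θ * length (part x)) labels                   ≤⟨ ∑-mono part-cost labels ⟩
          ∑ (λ x → θ * weight x + c * σ * (weight x * θ + weight x * occ x Q)) labels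
            ≡⟨ ∑-+ (λ x → θ * weight x) _ labels ⟩
          ∑ (λ x → θ * weight x) labels + ∑ (λ x → c * σ * (weight x * θ + weight x * occ x Q)) labels
            ≡⟨ cong₂ _+_ (∑-*ˡ θ weight labels) (trans (∑-*ˡ (c * σ) _ labels) (cong (c * σ *_) (trans (∑-+ (λ x → weight x * θ) _ labels)
                 (cong₂ _+_ (∑-*ʳ θ weight labels) (∑-occ Q))))) ⟩
          θ * ∑ weight labels + c * σ * (∑ weight labels * θ + wt Q)
            ≡⟨ eq₂ c σ θ (∑ weight labels) (wt Q) ⟩
          θ * ∑ weight labels + c * (σ * (θ * ∑ weight labels + wt Q))
            ≤⟨ +-mono-≤ (*-monoʳ-≤ θ total) (*-monoʳ-≤ c (*-monoʳ-≤ σ (+-monoˡ-≤ (wt Q) (*-monoʳ-≤ θ total)))) ⟩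
          θ * t + c * (σ * (θ * t + wt Q))                       ∎

-- Detours

length-++-mid : ∀ (xs ys zs : List A) → length ys ≤ length (xs ++ (ys ++ zs))
length-++-mid xs ys zs = begin
  length ys                        ≤⟨ m≤m+n _ (length zs) ⟩
  length ys + length zs            ≡⟨ sym (List.length-++ ys) ⟩
  length (ys ++ zs)                ≤⟨ m≤n+m _ (length xs) ⟩
  length xs + length (ys ++ zs)    ≡⟨ sym (List.length-++ xs) ⟩
  length (xs ++ (ys ++ zs))        ∎
  where open ≤-Reasoning

length-++-pre : ∀ (xs ys : List A) → length xs ≤ length (xs ++ ys)
length-++-pre xs ys = ≤-trans (m≤m+n _ (length ys)) (≤-reflexive (sym (List.length-++ xs)))

length-++-suf : ∀ (xs ys : List A) → length ys ≤ length (xs ++ ys)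
length-++-suf xs ys = ≤-trans (m≤n+m _ (length xs)) (≤-reflexive (sym (List.length-++ xs)))

module Routing {N : ℕ} (G : Graph N) {A : Regions.Region G} {R K t : ℕ} .{{_ : NonZero R}}
               (cov : Regions.Cover G A R K t) (r : ℕ) where

  open Spanners G
  open Covered cov

  Demand : Set
  Demand = V × V

  μ : ℕ
  μ = suc (K + K)

  private
    -- One route is fixed per demand, empty if its ends are too far apart. The last component
    -- records that a nonempty route comes from a geodesic, so that bought routes can be used
    -- without any assumption on their demands.
    route-data : ∀ d → ∃ λ ps → length ps ≤ r × (∀ x → occ x ps ≤ μ)
      × (∀ {ℓ} → GeoIn A (proj₁ d) (proj₂ d) ℓ → ℓ ≤ r * R → Chain (proj₁ d) ps (proj₂ d) ℓ)
      × (ps ≡ [] ⊎ ∃ λ ℓ → GeoIn A (proj₁ d) (proj₂ d) ℓ × Chain (proj₁ d) ps (proj₂ d) ℓ)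
    route-data (u , v) with within? A u v (r * R)
    ... | no ¬p = [] , z≤n , (λ _ → z≤n) , (λ (p , _) ℓ≤ → contradiction (weaken ℓ≤ p) ¬p) , inj₁ refl
    ... | yes p with geodesic (within? A) p
    ...   | ℓ , ℓ≤ , g with chain r g ℓ≤
    ...     | ps , |ps|≤r , c = ps , |ps|≤r , (λ x → occ≤ x c g) , (λ g′ _ → subst (Chain u ps v) (geo-unique g g′) c) , inj₂ (ℓ , g , c)

  route : Demand → List Piece
  route d = proj₁ (route-data d)

  length-route : ∀ d → length (route d) ≤ r
  length-route d = proj₁ (proj₂ (route-data d))

  occ-route : ∀ d x → occ x (route d) ≤ μ
  occ-route d = proj₁ (proj₂ (proj₂ (route-data d)))

  route-chain : ∀ {u v ℓ} → GeoIn A u v ℓ → ℓ ≤ r * R → Chain u (route (u , v)) v ℓ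
  route-chain {u} {v} = proj₁ (proj₂ (proj₂ (proj₂ (route-data (u , v)))))

  -- A list of at most one label, so that empty routes need no default; `ends` collects the first
  -- and the last label.
  leaders : List Piece → List Label
  leaders ps = map lab (take 1 ps)

  ends : List Piece → List Label
  ends ps = leaders ps ++ leaders (reverse ps)

  last∈ : ∀ p ps → ∃ λ b → b ∈ leaders (reverse (p ∷ ps))
  last∈ p ps with reverse (p ∷ ps) in eq
  ... | []    = contradiction (trans (sym (List.length-reverse (p ∷ ps))) (cong length eq)) λ ()
  ... | q ∷ _ = lab q , here refl

  chain-start∈ : ∀ {s ps t ℓ a} → Chain s ps t ℓ → a ∈ leaders ps → T (cluster a s)
  chain-start∈ (cons near _ _ _ _) (here refl) = near here

  -- The last piece has length at most `R`, and its cluster contains the `R`-ball of its start.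
  chain-end∈ : ∀ {s ps t ℓ b} → Chain s ps t ℓ → b ∈ leaders (reverse ps) → T (cluster b t)
  chain-end∈ {s} {ps} {t} {ℓ} c b∈ with reverse ps in eq
  chain-end∈ {s} {ps} {t} {ℓ} c (here refl) | q ∷ qs
    with chain-split (reverse qs) (subst (λ ps → Chain s ps t ℓ) ps≡ c)
    where
    ps≡ : ps ≡ reverse qs ++ q ∷ []
    ps≡ = trans (sym (List.reverse-involutive ps)) (trans (cong reverse eq) (List.unfold-reverse q qs))
  ... | _ , _ , _ , _ , cons near p a≤R _ [] , _ = near (weaken a≤R p)

  chain-at : ∀ {s ps t ℓ y} → Chain s ps t ℓ → y ∈ map lab ps → ∃ λ xs → ∃ λ ys → ps ≡ xs ++ ys ×
             ∃ λ z → ∃ λ a → ∃ λ b → Chain s xs z a × Chain z ys t b × a + b ≡ ℓ × T (cluster y z)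
  chain-at {s} {t = t} {ℓ} c y∈ with ∈-map⁻ lab y∈
  ... | p , p∈ , refl with ∈-∃++ p∈
  ...   | xs , ys , refl with chain-split xs c
  ...     | z , a , b , c₁ , c₂@(cons near _ _ _ _) , eq = xs , p ∷ ys , refl , z , a , b , c₁ , c₂ , eq , near here

  pre-∈ : ∀ {A : Set} {xs ys zs : List A} → zs ≡ xs ++ ys → ∀ {p} → p ∈ xs → p ∈ zs
  pre-∈ refl = ∈-++⁺ˡ

  suf-∈ : ∀ {A : Set} {ys zs : List A} xs → zs ≡ xs ++ ys → ∀ {p} → p ∈ ys → p ∈ zs
  suf-∈ xs refl = ∈-++⁺ʳ xs

  module Clipped (S : List Label) where

    private
      rest : Demand → List Piece
      rest d = dropWhile (avoid? S) (route d)

    -- `mid` runs from the first to the last piece with a label in `S`, found by cutting from both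
    -- sides. For a route that avoids `S`, everything is in `pre`.
    pre suf mid : Demand → List Piece
    pre d = cut S (route d)
    suf d = reverse (cut S (reverse (rest d)))
    mid d = reverse (dropWhile (avoid? S) (reverse (rest d)))

    mid++suf : ∀ d → mid d ++ suf d ≡ rest d
    mid++suf d = begin
      mid d ++ suf d               ≡⟨ sym (List.reverse-++ (cut S (reverse (rest d))) _) ⟩
      reverse (cut S (reverse (rest d)) ++ dropWhile (avoid? S) (reverse (rest d)))
                                   ≡⟨ cong reverse (List.takeWhile++dropWhile (avoid? S) (reverse (rest d))) ⟩
      reverse (reverse (rest d))   ≡⟨ List.reverse-involutive (rest d) ⟩
      rest d                       ∎
      where open ≡-Reasoning

    route-split : ∀ d → route d ≡ pre d ++ (mid d ++ suf d)
    route-split d = trans (sym (List.takeWhile++dropWhile (avoid? S) (route d))) (cong (pre d ++_) (sym (mid++suf d)))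

    -- The reversed route extends the reversed `rest` at its far end, which can only lengthen the
    -- cut. Thus a set hitting the prefixes of reversed routes also controls suffixes.
    wt-suf : ∀ d → wt (suf d) ≤ wt (cut S (reverse (route d)))
    wt-suf d = begin
      wt (suf d)                                              ≡⟨ ∑-reverse (weight ∘ lab) (cut S (reverse (rest d))) ⟩
      wt (cut S (reverse (rest d)))                           ≤⟨ ∑-cut-++ (weight ∘ lab) S (reverse (rest d)) (reverse (pre d)) ⟩
      wt (cut S (reverse (rest d) ++ reverse (pre d)))        ≡⟨ cong (wt ∘ cut S) (sym (List.reverse-++ (pre d) (rest d))) ⟩
      wt (cut S (reverse (pre d ++ rest d)))                  ≡⟨ cong (wt ∘ cut S ∘ reverse) (List.takeWhile++dropWhile (avoid? S) (route d)) ⟩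
      wt (cut S (reverse (route d)))                          ∎
      where open ≤-Reasoning

    pre∉S : ∀ d {p} → p ∈ pre d → ¬ (lab p ∈ S)
    pre∉S d = All.lookup (all-takeWhile (avoid? S) (route d))

    suf∉S : ∀ d {p} → p ∈ suf d → ¬ (lab p ∈ S)
    suf∉S d p∈ = All.lookup (all-takeWhile (avoid? S) (reverse (rest d))) (Any.reverse⁻ p∈)

    length-mid : ∀ d → length (mid d) ≤ r
    length-mid d = ≤-trans (length-++-mid (pre d) (mid d) (suf d))
                           (≤-trans (≤-reflexive (cong length (sym (route-split d)))) (length-route d))

    occ-mid : ∀ d x → occ x (mid d) ≤ μ
    occ-mid d x = begin
      occ x (mid d)                                          ≤⟨ m≤m+n _ (occ x (suf d)) ⟩
      occ x (mid d) + occ x (suf d)                          ≤⟨ m≤n+m _ (occ x (pre d)) ⟩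
      occ x (pre d) + (occ x (mid d) + occ x (suf d))        ≡⟨ cong (occ x (pre d) +_) (sym (∑-++ _ (mid d) (suf d))) ⟩
      occ x (pre d) + occ x (mid d ++ suf d)                 ≡⟨ sym (∑-++ _ (pre d) (mid d ++ suf d)) ⟩
      occ x (pre d ++ (mid d ++ suf d))                      ≡⟨ cong (occ x) (sym (route-split d)) ⟩
      occ x (route d)                                        ≤⟨ occ-route d x ⟩
      μ                                                      ∎
      where open ≤-Reasoning

    leaders-dropWhile : ∀ ps {a} → a ∈ leaders (dropWhile (avoid? S) ps) → a ∈ S
    leaders-dropWhile (p ∷ ps) a∈ with lab p ∈? S
    leaders-dropWhile (p ∷ ps) (here refl) | yes p∈ = p∈
    ... | no _ = leaders-dropWhile ps a∈

    leaders-++ : ∀ ps qs {a} → a ∈ leaders ps → a ∈ leaders (ps ++ qs)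
    leaders-++ (p ∷ ps) qs a∈ = a∈

    ends∈S : ∀ d {a} → a ∈ ends (mid d) → a ∈ S
    ends∈S d a∈ with ∈-++⁻ (leaders (mid d)) a∈
    ... | inj₁ a∈₁ = leaders-dropWhile (route d) (subst (λ ps → _ ∈ leaders ps) (mid++suf d) (leaders-++ (mid d) (suf d) a∈₁))
    ... | inj₂ a∈₂ = leaders-dropWhile (reverse (rest d)) (subst (λ ps → _ ∈ leaders ps) (List.reverse-involutive _) a∈₂)

    open Greedy lab weight mid (ends ∘ mid) public

    private
      mid-chain : ∀ d → mid d ≡ [] ⊎ ∃ λ s → ∃ λ t → ∃ λ ℓ → GeoIn A s t ℓ × Chain s (mid d) t ℓ
      mid-chain d with proj₂ (proj₂ (proj₂ (proj₂ (route-data d))))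
      ... | inj₁ eq = inj₁ (List.++-conicalˡ (mid d) (suf d) (List.++-conicalʳ (pre d) _ (trans (sym (route-split d)) eq)))
      ... | inj₂ (ℓ , g , c) with chain-split (pre d) (subst (λ ps → Chain _ ps _ ℓ) (route-split d) c)
      ...   | s , a , b , c₁ , c₂ , refl with chain-split (mid d) c₂ | geo-suffix g (chain-within c₁) (chain-within c₂)
      ...     | t , a′ , b′ , c₃ , c₄ , refl | g′ = inj₂ (s , t , a′ , geo-prefix g′ (chain-within c₃) (chain-within c₄) , c₃)

    module Serving (e : ℕ) (H : List (V × V))
      (diam-H : ∀ x {u v} → T (cluster x u) → T (cluster x v) → Within (Span H) u v diam)
      (ds B : List Demand)
      (covered : ∀ {d} → d ∈ ds → d ∈ B ⊎ Bypassed B d)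
      (served : ∀ {d} → d ∈ B → ∀ {p} → p ∈ mid d → Served e H p) where

      serve-≤ : ∀ {s ps t ℓ} → length ps ≤ r → Chain s ps t ℓ → GeoIn A s t ℓ → (∀ {p} → p ∈ ps → Served e H p) →
                Within (Span H) s t (ℓ + r * e)
      serve-≤ {ℓ = ℓ} |ps|≤r c g srv = weaken (+-monoʳ-≤ ℓ (*-monoˡ-≤ e |ps|≤r)) (chain-served c g srv)

      -- The part of the bought section between its end `a` and `y` is served piece by piece. It is
      -- kept as a geodesic of `A`, so that its length can later be compared with that of another
      -- demand.
      touched-reach : ∀ {y a} → Touched B y a → ∃ λ u → ∃ λ z → ∃ λ ℓ → T (cluster a u) × T (cluster y z)
                                              × GeoIn A u z ℓ × Within (Span H) u z (ℓ + r * e)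
      touched-reach touched with find touched
      ... | d , d∈ , a∈ , y∈ with mid-chain d
      ...   | inj₁ eq = contradiction (subst (λ ps → _ ∈ map lab ps) eq y∈) λ ()
      ...   | inj₂ (s , t , ℓ , g , c) with chain-at c y∈
      ...     | xs , ys , eq , z , a′ , b′ , c₁ , c₂ , refl , z∈ with ∈-++⁻ (leaders (mid d)) a∈
      ...       | inj₁ a∈₁ = s , z , a′ , chain-start∈ c a∈₁ , z∈ , g₁ , serve-≤ |xs|≤r c₁ g₁ (served d∈ ∘ pre-∈ eq)
        where
        g₁ = geo-prefix g (chain-within c₁) (chain-within c₂)
        |xs|≤r = ≤-trans (≤-trans (length-++-pre xs ys) (≤-reflexive (cong length (sym eq)))) (length-mid d)
      ...       | inj₂ a∈₂ = t , z , b′ , chain-end∈ c a∈₂ , z∈ , geo-flip (inside-sym A) g₂ ,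
                             flip (span-sym H) (serve-≤ |ys|≤r c₂ g₂ (served d∈ ∘ suf-∈ xs eq))
        where
        g₂ = geo-suffix g (chain-within c₁) (chain-within c₂)
        |ys|≤r = ≤-trans (≤-trans (length-++-suf xs ys) (≤-reflexive (cong length (sym eq)))) (length-mid d)

      -- The route goes from `s` across the first cluster, along one bought section to `y`, across
      -- `y`, back along another section, and across the last cluster to `t`. The lengths of both
      -- sections are distances, hence at most `a` and `b` plus two diameters each; with three
      -- crossings this makes seven diameters.
      detour : ∀ {s t ℓ y} ps → Chain s ps t ℓ → GeoIn A s t ℓ → y ∈ map lab ps → All (Touched B y) (ends ps) →
               Within (Span H) s t (ℓ + (7 * diam + 2 * (r * e)))
      detour {s} {t} {ℓ} {y} ps@(p ∷ ps′) c g y∈ all with chain-at c y∈ | last∈ p ps′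
      ... | _ , _ , _ , z , a , b , c₁ , c₂ , refl , z∈ | l , l∈
        with touched-reach (All.lookup all (here refl)) | touched-reach (All.lookup all (∈-++⁺ʳ (leaders ps) l∈))
      ...   | u₁ , z₁ , ℓ₁ , u₁∈ , z₁∈ , (_ , min₁) , h₁ | u₂ , z₂ , ℓ₂ , u₂∈ , z₂∈ , (_ , min₂) , h₂ =
        weaken bound (diam-H (lab p) s∈ u₁∈ ⁀ h₁ ⁀ diam-H y z₁∈ z₂∈ ⁀ flip (span-sym H) h₂ ⁀ diam-H l u₂∈ t∈)
        where
        open ≤-Reasoning
        s∈ = chain-start∈ c (here refl)
        t∈ = chain-end∈ c l∈
        q = r * e
        ℓ₁≤ : ℓ₁ ≤ diam + (a + diam)
        ℓ₁≤ = min₁ (cluster-diam u₁∈ s∈ ⁀ chain-within c₁ ⁀ cluster-diam z∈ z₁∈)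
        ℓ₂≤ : ℓ₂ ≤ diam + (b + diam)
        ℓ₂≤ = min₂ (cluster-diam u₂∈ t∈ ⁀ flip (inside-sym A) (chain-within c₂) ⁀ cluster-diam z∈ z₂∈)
        eq : ∀ D a b q → D + (D + (a + D) + q + (D + (D + (b + D) + q + D))) ≡ a + b + (7 * D + 2 * q)
        eq = solve-∀
        bound : diam + (ℓ₁ + q + (diam + (ℓ₂ + q + diam))) ≤ a + b + (7 * diam + 2 * q)
        bound = begin
          diam + (ℓ₁ + q + (diam + (ℓ₂ + q + diam)))
            ≤⟨ +-monoʳ-≤ diam (+-mono-≤ (+-monoˡ-≤ q ℓ₁≤) (+-monoʳ-≤ diam (+-monoˡ-≤ diam (+-monoˡ-≤ q ℓ₂≤)))) ⟩
          diam + (diam + (a + diam) + q + (diam + (diam + (b + diam) + q + diam)))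
            ≡⟨ eq diam a b q ⟩
          a + b + (7 * diam + 2 * q) ∎

      mid-reach : ∀ {d s t ℓ} → d ∈ ds → Chain s (mid d) t ℓ → GeoIn A s t ℓ →
                  Within (Span H) s t (ℓ + (7 * diam + 2 * (r * e)))
      mid-reach {d} {ℓ = ℓ} d∈ c g with covered d∈
      ... | inj₁ d∈B = weaken (+-monoʳ-≤ ℓ (≤-trans (m≤n*m (r * e) 2) (m≤n+m _ (7 * diam)))) (serve-≤ (length-mid d) c g (served d∈B))
      ... | inj₂ bypassed with find bypassed
      ...   | y , y∈ , all = detour (mid d) c g y∈ all

      route-reach : ∀ {u v ℓ} → (u , v) ∈ ds → GeoIn A u v ℓ → ℓ ≤ r * R →
                    (∀ {p} → p ∈ pre (u , v) → Served e H p) → (∀ {p} → p ∈ suf (u , v) → Served e H p) →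
                    Within (Span H) u v (ℓ + (7 * diam + 4 * (r * e)))
      route-reach {u} {v} {ℓ} d∈ g ℓ≤ srv-pre srv-suf
        with chain-split (pre (u , v)) (subst (λ ps → Chain u ps v ℓ) (route-split (u , v)) (route-chain g ℓ≤))
      ... | s , a , b , c₁ , c₂ , refl
        with chain-split (mid (u , v)) c₂ | geo-suffix g (chain-within c₁) (chain-within c₂)
      ...   | t , a′ , b′ , c₃ , c₄ , refl | g₂ =
        weaken (≤-reflexive (eq a a′ b′ (r * e) diam))
          (serve-≤ (≤-trans (length-++-pre (pre d) _) |route|≤r) c₁ (geo-prefix g (chain-within c₁) (chain-within c₂)) srv-pre
            ⁀ mid-reach d∈ c₃ (geo-prefix g₂ (chain-within c₃) (chain-within c₄))
            ⁀ serve-≤ (≤-trans (≤-trans (length-++-suf (mid d) (suf d)) (length-++-suf (pre d) _)) |route|≤r) c₄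
                      (geo-suffix g₂ (chain-within c₃) (chain-within c₄)) srv-suf)
        where
        d = u , v
        |route|≤r = ≤-trans (≤-reflexive (cong length (sym (route-split d)))) (length-route d)
        eq : ∀ a b c q D → a + q + (b + (7 * D + 2 * q) + (c + q)) ≡ a + (b + c) + (7 * D + 4 * q)
        eq = solve-∀

-- The induction step

length-filter-*-≤∑ : ∀ {P : A → Set} (P? : ∀ x → Dec (P x)) (f : A → ℕ) {L} → (∀ {x} → P x → L ≤ f x) →
                     ∀ xs → length (filter P? xs) * L ≤ ∑ f xs
length-filter-*-≤∑ P? f L≤f []       = z≤n
length-filter-*-≤∑ P? f L≤f (x ∷ xs) with P? x
... | yes p = +-mono-≤ (L≤f p) (length-filter-*-≤∑ P? f L≤f xs)
... | no _  = ≤-trans (length-filter-*-≤∑ P? f L≤f xs) (m≤n+m _ (f x))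

module Constants (κ : ℕ) where

  -- `K` is the radius factor of the cover, `μ` the bound on visits to one cluster, and `γ` absorbs
  -- the numerical constants of both cost estimates of the induction step.
  K μ γ : ℕ
  K = 2 ^ suc κ
  μ = suc (K + K)
  γ = 3 + 5 * (μ * suc κ)

  -- Seven cluster diameters and four chain errors: two on the detour, one each on prefix and
  -- suffix.
  error : (r R e : ℕ) → ℕ
  error r R e = 7 * (K * R + K * R) + 4 * (r * e)

  -- The recursion of `error` with `R` = r^k and `r * e` at most `stretch k * r ^ k`, after division
  -- by r^k.
  stretch : ℕ → ℕ
  stretch zero    = 0
  stretch (suc k) = 14 * K + 4 * stretch k

module Steps {N : ℕ} (G : Graph N) (κ ν : ℕ) .{{_ : NonZero ν}} (N≤ν^κ : N ≤ ν ^ κ)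
             (σ : ℕ) .{{_ : NonZero σ}} where

  open Spanners G
  open Constants κ

  -- For θ ≥ 1 the bound on H reads |H| ≤ c |B| σ (1 + |P|/θ).
  Pairwise : (R e θ c : ℕ) → Set
  Pairwise R e θ c = ∀ B (P : List (V × V)) → ∃ λ H →
    θ * length H ≤ c * (size B * (σ * (θ + length P))) ×
    (∀ {u v ℓ} → (u , v) ∈ P → GeoIn B u v ℓ → ℓ ≤ R → Within (Span H) u v (ℓ + e))

  AllPairs : (R e L c : ℕ) → Set
  AllPairs R e L c = ∀ B → size B ≤ L → ∃ λ H → length H ≤ c * (size B * σ) ×
    (∀ {u v ℓ} → GeoIn B u v ℓ → ℓ ≤ R → Within (Span H) u v (ℓ + e))

  module _ {r R e θ c : ℕ} .{{_ : NonZero R}} .{{_ : NonZero θ}} .{{_ : NonZero c}} (pairwise : Pairwise R e θ c) where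

    module _ (A : Region) where

      private
        t : ℕ
        t = suc κ * (ν * size A)

        cov : Cover A R K t
        cov = cover κ ν N≤ν^κ A R

      open Covered cov public hiding (diam)
      open Routing G cov r public hiding (μ)
      open Buy c σ θ e pairwise public

      wt-bodies : ∀ S B → (∀ y → occ y (concatMap (Clipped.mid S) B) ≤ μ * length S) →
                  wt (concatMap (Clipped.mid S) B) ≤ t * (μ * length S)
      wt-bodies S B occ≤ = begin
        wt Q                                              ≡⟨ sym (∑-occ Q) ⟩
        ∑ (λ x → weight x * occ x Q) (allFin num)         ≤⟨ ∑-mono (λ x → *-monoʳ-≤ (weight x) (occ≤ x)) (allFin num) ⟩
        ∑ (λ x → weight x * (μ * length S)) (allFin num)  ≡⟨ ∑-*ʳ (μ * length S) weight (allFin num) ⟩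
        ∑ weight (allFin num) * (μ * length S)            ≤⟨ *-monoˡ-≤ (μ * length S) total ⟩
        t * (μ * length S)                                ∎
        where
        open ≤-Reasoning
        Q = concatMap (Clipped.mid S) B

      -- The θ clusters of `S` hit the routes and their reversals. Then prefixes and suffixes weigh
      -- at most 4pμt/θ and the greedily bought middle sections at most tμθ; `buy` divides by θ once
      -- more, whence the new threshold θ².
      pairwise-step-at : ∀ P → ∃ λ H →
        θ * θ * length H ≤ suc κ * (ν * (ν * (c * γ))) * (size A * (σ * (θ * θ + length P))) ×
        (∀ {u v ℓ} → (u , v) ∈ P → GeoIn A u v ℓ → ℓ ≤ r * R → Within (Span H) u v (ℓ + error r R e))
      pairwise-step-at P = H , cost , λ {u} {v} d∈ g ℓ≤ → route-reach d∈ g ℓ≤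
          (λ p∈ → served (∈-++⁺ˡ (∈-concatMap⁺ pre (lose d∈ p∈))))
          (λ p∈ → served (∈-++⁺ʳ (concatMap pre P) (∈-++⁺ˡ (∈-concatMap⁺ suf (lose d∈ p∈)))))
        where
        p = length P
        L : List (List Piece)
        L = map route P ++ map (reverse ∘ route) P
        occ-L : ∀ {l} → l ∈ L → ∀ x → occ x l ≤ μ
        occ-L l∈ x with ∈-++⁻ (map route P) l∈
        ... | inj₁ l∈₁ with ∈-map⁻ route l∈₁
        ...   | d , _ , refl = occ-route d x
        occ-L l∈ x | inj₂ l∈₂ with ∈-map⁻ (reverse ∘ route) l∈₂
        ...   | d , _ , refl = ≤-trans (≤-reflexive (∑-reverse _ (route d))) (occ-route d x)
        hit = hitting-set μ t total L occ-L θ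
        S = proj₁ hit
        open Clipped S
        X : ℕ
        X = ∑ (wt ∘ cut S) L
        greedy = greedy-cover μ S occ-mid ends∈S P
        bought = proj₁ greedy
        Q : List Piece
        Q = concatMap pre P ++ (concatMap suf P ++ concatMap mid bought)
        purchase = buy Q
        H = proj₁ purchase
        served = proj₂ (proj₂ (proj₂ purchase))
        open Serving e H (proj₁ (proj₂ (proj₂ purchase))) P bought (proj₁ (proj₂ greedy))
          (λ d∈ p∈ → served (∈-++⁺ʳ (concatMap pre P) (∈-++⁺ʳ (concatMap suf P) (∈-concatMap⁺ mid (lose d∈ p∈)))))
        open ≤-Reasoning
        wt-Q : wt Q ≤ X + t * (μ * θ)
        wt-Q = begin
          wt Q
            ≡⟨ trans (∑-++ _ (concatMap pre P) _) (cong (wt (concatMap pre P) +_) (∑-++ _ (concatMap suf P) _)) ⟩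
          wt (concatMap pre P) + (wt (concatMap suf P) + wt (concatMap mid bought))
            ≡⟨ sym (+-assoc (wt (concatMap pre P)) _ _) ⟩
          wt (concatMap pre P) + wt (concatMap suf P) + wt (concatMap mid bought)
            ≤⟨ +-mono-≤ (+-mono-≤ (≤-reflexive (∑-concatMap _ pre P)) (≤-trans (≤-reflexive (∑-concatMap _ suf P)) (∑-mono wt-suf P)))
                        (≤-trans (wt-bodies S bought (proj₂ (proj₂ greedy))) (*-monoʳ-≤ t (*-monoʳ-≤ μ (proj₁ (proj₂ hit))))) ⟩
          ∑ (wt ∘ pre) P + ∑ (λ d → wt (cut S (reverse (route d)))) P + t * (μ * θ)
            ≡⟨ cong (_+ t * (μ * θ)) (sym (trans (∑-++ _ (map route P) _) (cong₂ _+_ (∑-map _ route P) (∑-map _ (reverse ∘ route) P)))) ⟩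
          X + t * (μ * θ) ∎
        |L| : length L ≡ p + p
        |L| = trans (List.length-++ (map route P)) (cong₂ _+_ (List.length-map route P) (List.length-map (reverse ∘ route) P))
        e₁ : ∀ θ t c σ X μ → θ * (θ * t + c * (σ * (θ * t + (X + t * (μ * θ)))))
                           ≡ θ * θ * t + c * (σ * (θ * θ * t + (θ * X + t * (μ * (θ * θ)))))
        e₁ = solve-∀
        -- With q = θ², the bracketed last summand on the left is slack that completes the cost to a
        -- product with the factor q + p.
        e₂ : ∀ q t c σ p μ → q * t * σ + c * (σ * (q * t + ((p + p) * (2 * μ) * t + t * (μ * q))))
                             + (p * t * σ + c * (σ * (p * t + t * (μ * (4 * q + p)))))
                           ≡ t * (σ * (q + p)) * (1 + c * (1 + 5 * μ))
        e₂ = solve-∀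
        e₃ : ∀ c μ → c + c * (1 + 5 * μ) ≡ c * (2 + 5 * μ)
        e₃ = solve-∀
        e₄ : ∀ k n s T f → k * (n * s) * T * (n * f) ≡ k * (n * (n * f)) * (s * T)
        e₄ = solve-∀
        const≤ : 1 + c * (1 + 5 * μ) ≤ ν * (c * γ)
        const≤ = begin
          1 + c * (1 + 5 * μ)  ≤⟨ +-monoˡ-≤ _ (>-nonZero⁻¹ c) ⟩
          c + c * (1 + 5 * μ)  ≡⟨ e₃ c μ ⟩
          c * (2 + 5 * μ)      ≤⟨ *-monoʳ-≤ c (+-mono-≤ (n≤1+n 2) (*-monoʳ-≤ 5 (m≤m*n μ (suc κ)))) ⟩
          c * γ                ≤⟨ m≤n*m (c * γ) ν ⟩
          ν * (c * γ)          ∎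
        cost : θ * θ * length H ≤ suc κ * (ν * (ν * (c * γ))) * (size A * (σ * (θ * θ + p)))
        cost = begin
          θ * θ * length H                                       ≡⟨ *-assoc θ θ _ ⟩
          θ * (θ * length H)                                     ≤⟨ *-monoʳ-≤ θ (proj₁ (proj₂ purchase)) ⟩
          θ * (θ * t + c * (σ * (θ * t + wt Q)))                 ≤⟨ *-monoʳ-≤ θ (+-monoʳ-≤ (θ * t) (*-monoʳ-≤ c (*-monoʳ-≤ σ (+-monoʳ-≤ (θ * t) wt-Q)))) ⟩
          θ * (θ * t + c * (σ * (θ * t + (X + t * (μ * θ)))))    ≡⟨ e₁ θ t c σ X μ ⟩
          θ * θ * t + c * (σ * (θ * θ * t + (θ * X + t * (μ * (θ * θ)))))
            ≤⟨ +-mono-≤ (m≤m*n (θ * θ * t) σ) (*-monoʳ-≤ c (*-monoʳ-≤ σ (+-monoʳ-≤ (θ * θ * t) (+-monoˡ-≤ _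
                 (≤-trans (proj₂ (proj₂ hit)) (≤-reflexive (cong (λ l → l * (2 * μ) * t) |L|))))))) ⟩
          θ * θ * t * σ + c * (σ * (θ * θ * t + ((p + p) * (2 * μ) * t + t * (μ * (θ * θ)))))
            ≤⟨ m≤m+n _ _ ⟩
          _ ≡⟨ e₂ (θ * θ) t c σ p μ ⟩
          t * (σ * (θ * θ + p)) * (1 + c * (1 + 5 * μ))          ≤⟨ *-monoʳ-≤ (t * (σ * (θ * θ + p))) const≤ ⟩
          t * (σ * (θ * θ + p)) * (ν * (c * γ))                  ≡⟨ e₄ (suc κ) ν (size A) (σ * (θ * θ + p)) (c * γ) ⟩
          suc κ * (ν * (ν * (c * γ))) * (size A * (σ * (θ * θ + p))) ∎

      module _ (L : ℕ) .{{_ : NonZero L}} (allPairs : AllPairs R e L c) where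

        -- Since the clusters have total size at most `t`, few of them exceed `L`; these form `S`.
        -- The cost of the middle sections depends on the length of `S` and not on the number of
        -- demands, so all pairs of vertices can be demanded. Prefixes and suffixes stay in clusters
        -- of size at most `L`.
        allPairs-step-at : size A ≤ θ * L → ∃ λ H →
          length H ≤ suc κ * (ν * (ν * (c * γ))) * (size A * σ) ×
          (∀ {u v ℓ} → GeoIn A u v ℓ → ℓ ≤ r * R → Within (Span H) u v (ℓ + error r R e))
        allPairs-step-at |A|≤θL = H , cost , λ {u} {v} g ℓ≤ → route-reach (∈-cartesianProduct⁺ (∈-allFin u) (∈-allFin v)) g ℓ≤
            (λ p∈ → served-small (pre∉S (u , v) p∈)) (λ p∈ → served-small (suf∉S (u , v) p∈))
          where
          labels : List Label
          labels = allFin num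
          S : List Label
          S = filter (λ x → L <? weight x) labels
          ds = cartesianProduct (allFin N) (allFin N)
          open Clipped S
          greedy = greedy-cover μ S occ-mid ends∈S ds
          bought = proj₁ greedy
          Q = concatMap mid bought
          purchase = buy Q
          H₁ = proj₁ purchase
          -- The empty default concerns the clusters in `S` only, for which `small-spec` is never
          -- invoked.
          small : Label → List (V × V)
          small x with weight x ≤? L
          ... | yes w≤L = proj₁ (allPairs (cluster x) w≤L)
          ... | no _    = []
          length-small : ∀ x → length (small x) ≤ c * (weight x * σ)
          length-small x with weight x ≤? L
          ... | yes w≤L = proj₁ (proj₂ (allPairs (cluster x) w≤L))
          ... | no _    = z≤n
          small-spec : ∀ x → weight x ≤ L → ∀ {u v ℓ} → GeoIn (cluster x) u v ℓ → ℓ ≤ R → Within (Span (small x)) u v (ℓ + e)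
          small-spec x w≤L with weight x ≤? L
          ... | yes w≤L′ = proj₂ (proj₂ (allPairs (cluster x) w≤L′))
          ... | no w≰L   = contradiction w≤L w≰L
          H₂ = concatMap small labels
          H = H₁ ++ H₂
          served-small : ∀ {p} → ¬ (lab p ∈ S) → Served e H p
          served-small {p} p∉ g ℓ≤R = span-mono (λ i → ∈-++⁺ʳ H₁ (∈-concatMap⁺ small (lose (∈-allFin (lab p)) i)))
            (small-spec (lab p) (≮⇒≥ λ L<w → p∉ (∈-filter⁺ (λ x → L <? weight x) (∈-allFin (lab p)) L<w)) g ℓ≤R)
          open Serving e H (λ x u∈ v∈ → span-mono ∈-++⁺ˡ (proj₁ (proj₂ (proj₂ purchase)) x u∈ v∈)) ds bought (proj₁ (proj₂ greedy))
            (λ d∈ p∈ g ℓ≤R → span-mono ∈-++⁺ˡ (proj₂ (proj₂ (proj₂ purchase)) (∈-concatMap⁺ mid (lose d∈ p∈)) g ℓ≤R))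
          open ≤-Reasoning
          e₁ : ∀ k n θ L → k * (n * (θ * L)) ≡ k * (n * θ) * L
          e₁ = solve-∀
          |S|≤ : length S ≤ suc κ * (ν * θ)
          |S|≤ = *-cancelʳ-≤ _ _ L (begin
            length S * L              ≤⟨ length-filter-*-≤∑ (λ x → L <? weight x) weight <⇒≤ labels ⟩
            ∑ weight labels           ≤⟨ total ⟩
            suc κ * (ν * size A)      ≤⟨ *-monoʳ-≤ (suc κ) (*-monoʳ-≤ ν |A|≤θL) ⟩
            suc κ * (ν * (θ * L))     ≡⟨ e₁ (suc κ) ν θ L ⟩
            suc κ * (ν * θ) * L       ∎)
          e₂ : ∀ θ t c σ μ k n → θ * t + c * (σ * (θ * t + t * (μ * (k * (n * θ))))) ≡ θ * (t + c * (σ * (t + t * (μ * (k * n)))))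
          e₂ = solve-∀
          |H₁|≤ : length H₁ ≤ t + c * (σ * (t + t * (μ * (suc κ * ν))))
          |H₁|≤ = *-cancelˡ-≤ θ (begin
            θ * length H₁                                                       ≤⟨ proj₁ (proj₂ purchase) ⟩
            θ * t + c * (σ * (θ * t + wt Q))
              ≤⟨ +-monoʳ-≤ (θ * t) (*-monoʳ-≤ c (*-monoʳ-≤ σ (+-monoʳ-≤ (θ * t)
                   (≤-trans (wt-bodies S bought (proj₂ (proj₂ greedy))) (*-monoʳ-≤ t (*-monoʳ-≤ μ |S|≤)))))) ⟩
            θ * t + c * (σ * (θ * t + t * (μ * (suc κ * (ν * θ)))))             ≡⟨ e₂ θ t c σ μ (suc κ) ν ⟩
            θ * (t + c * (σ * (t + t * (μ * (suc κ * ν)))))                     ∎)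
          |H₂|≤ : length H₂ ≤ c * (t * σ)
          |H₂|≤ = begin
            length H₂                              ≡⟨ length-concatMap small labels ⟩
            ∑ (length ∘ small) labels              ≤⟨ ∑-mono length-small labels ⟩
            ∑ (λ x → c * (weight x * σ)) labels    ≡⟨ trans (∑-*ˡ c _ labels) (cong (c *_) (∑-*ʳ σ weight labels)) ⟩
            c * (∑ weight labels * σ)              ≤⟨ *-monoʳ-≤ c (*-monoˡ-≤ σ total) ⟩
            c * (t * σ)                            ∎
          e₃ : ∀ t σ c μ k n → t * σ + c * (σ * (t + t * (μ * (k * n)))) + c * (t * σ) ≡ t * σ * (1 + c * (2 + μ * k * n))
          e₃ = solve-∀
          e₄ : ∀ k n s σ f → k * (n * s) * σ * (n * f) ≡ k * (n * (n * f)) * (s * σ)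
          e₄ = solve-∀
          e₅ : ∀ c n z → c * n + c * (2 * n + z * n) ≡ n * (c * (3 + z))
          e₅ = solve-∀
          const≤ : 1 + c * (2 + μ * suc κ * ν) ≤ ν * (c * γ)
          const≤ = begin
            1 + c * (2 + μ * suc κ * ν)              ≤⟨ +-mono-≤ (*-mono-≤ (>-nonZero⁻¹ c) (>-nonZero⁻¹ ν)) (*-monoʳ-≤ c (+-monoˡ-≤ _ (m≤m*n 2 ν))) ⟩
            c * ν + c * (2 * ν + μ * suc κ * ν)      ≡⟨ e₅ c ν (μ * suc κ) ⟩
            ν * (c * (3 + μ * suc κ))                ≤⟨ *-monoʳ-≤ ν (*-monoʳ-≤ c (+-monoʳ-≤ 3 (m≤n*m (μ * suc κ) 5))) ⟩
            ν * (c * γ)                              ∎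
          cost : length H ≤ suc κ * (ν * (ν * (c * γ))) * (size A * σ)
          cost = begin
            length H                                                        ≡⟨ List.length-++ H₁ ⟩
            length H₁ + length H₂                                           ≤⟨ +-mono-≤ |H₁|≤ |H₂|≤ ⟩
            t + c * (σ * (t + t * (μ * (suc κ * ν)))) + c * (t * σ)         ≤⟨ +-monoˡ-≤ (c * (t * σ)) (+-monoˡ-≤ _ (m≤m*n t σ)) ⟩
            t * σ + c * (σ * (t + t * (μ * (suc κ * ν)))) + c * (t * σ)     ≡⟨ e₃ t σ c μ (suc κ) ν ⟩
            t * σ * (1 + c * (2 + μ * suc κ * ν))                           ≤⟨ *-monoʳ-≤ (t * σ) const≤ ⟩
            t * σ * (ν * (c * γ))                                           ≡⟨ e₄ (suc κ) ν (size A) σ (c * γ) ⟩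
            suc κ * (ν * (ν * (c * γ))) * (size A * σ)                      ∎

    pairwise-step : Pairwise (r * R) (error r R e) (θ * θ) (suc κ * (ν * (ν * (c * γ))))
    pairwise-step = pairwise-step-at

    allPairs-step : ∀ L .{{_ : NonZero L}} → AllPairs R e L c → AllPairs (r * R) (error r R e) (θ * L) (suc κ * (ν * (ν * (c * γ))))
    allPairs-step L allPairs A = allPairs-step-at A L allPairs

-- All levels at one scale

length-cartesianProduct : ∀ {A B : Set} (xs : List A) (ys : List B) → length (cartesianProduct xs ys) ≡ length xs * length ys
length-cartesianProduct []       ys = refl
length-cartesianProduct (x ∷ xs) ys = trans (List.length-++ (map (x ,_) ys))
  (cong₂ _+_ (List.length-map (x ,_) ys) (length-cartesianProduct xs ys))

unique-⊆-length : {xs ys : List A} → Unique xs → xs ⊆ᴸ ys → length xs ≤ length ys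
unique-⊆-length []       _     = z≤n
unique-⊆-length {xs = x ∷ xs} (x∉ ∷ uniq) xs⊆ys with ∈-∃++ (xs⊆ys (here refl))
... | ys₁ , ys₂ , refl = ≤-trans (s≤s (unique-⊆-length uniq xs⊆)) (≤-reflexive (begin
  suc (length (ys₁ ++ ys₂))          ≡⟨ cong suc (List.length-++ ys₁) ⟩
  suc (length ys₁ + length ys₂)      ≡⟨ sym (+-suc (length ys₁) (length ys₂)) ⟩
  length ys₁ + length (x ∷ ys₂)      ≡⟨ sym (List.length-++ ys₁) ⟩
  length (ys₁ ++ x ∷ ys₂)            ∎))
  where
  open ≡-Reasoning
  xs⊆ : xs ⊆ᴸ ys₁ ++ ys₂
  xs⊆ {z} z∈ with ∈-++⁻ ys₁ (xs⊆ys (there z∈))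
  ... | inj₁ z∈₁             = ∈-++⁺ˡ z∈₁
  ... | inj₂ (here refl)     = contradiction refl (All.lookup x∉ z∈)
  ... | inj₂ (there z∈₂)     = ∈-++⁺ʳ ys₁ z∈₂

module Iteration {N : ℕ} (G : Graph N) (κ ν : ℕ) .{{ν≢0 : NonZero ν}} (N≤ν^κ : N ≤ ν ^ κ)
                 (σ : ℕ) .{{σ≢0 : NonZero σ}} (r : ℕ) .{{_ : NonZero r}} where

  open Spanners G
  open Constants κ
  open Steps G κ ν N≤ν^κ σ {{σ≢0}}

  err : ℕ → ℕ
  err zero    = 0
  err (suc k) = error r (r ^ k) (err k)

  r*err≤ : ∀ k → r * err k ≤ stretch k * r ^ k
  err-suc≤ : ∀ k → err (suc k) ≤ stretch (suc k) * r ^ k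

  r*err≤ zero    = ≤-reflexive (*-zeroʳ r)
  r*err≤ (suc k) = begin
    r * err (suc k)                    ≤⟨ *-monoʳ-≤ r (err-suc≤ k) ⟩
    r * (stretch (suc k) * r ^ k)      ≡⟨ e r (stretch (suc k)) (r ^ k) ⟩
    stretch (suc k) * r ^ suc k        ∎
    where
    open ≤-Reasoning
    e : ∀ a b c → a * (b * c) ≡ b * (a * c)
    e = solve-∀
  err-suc≤ k = begin
    7 * (K * r ^ k + K * r ^ k) + 4 * (r * err k)          ≤⟨ +-monoʳ-≤ (7 * (K * r ^ k + K * r ^ k)) (*-monoʳ-≤ 4 (r*err≤ k)) ⟩
    7 * (K * r ^ k + K * r ^ k) + 4 * (stretch k * r ^ k)  ≡⟨ e K (r ^ k) (stretch k) ⟩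
    stretch (suc k) * r ^ k                                ∎
    where
    open ≤-Reasoning
    e : ∀ K R s → 7 * (K * R + K * R) + 4 * (s * R) ≡ (14 * K + 4 * s) * R
    e = solve-∀

  -- Recursions in the form in which the steps produce them; `threshold≡`, `limit≡` and `cost≡` give
  -- the closed forms.
  threshold limit cost : ℕ → ℕ
  threshold zero    = σ * σ
  threshold (suc k) = threshold k * threshold k
  limit zero        = σ
  limit (suc k)     = threshold k * limit k
  cost zero         = 1
  cost (suc k)      = suc κ * (ν * (ν * (cost k * γ)))

  threshold≢0 : ∀ k → NonZero (threshold k)
  threshold≢0 zero    = m*n≢0 σ σ
  threshold≢0 (suc k) = m*n≢0 (threshold k) (threshold k) {{threshold≢0 k}} {{threshold≢0 k}}

  limit≢0 : ∀ k → NonZero (limit k)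
  limit≢0 zero    = >-nonZero (>-nonZero⁻¹ σ)
  limit≢0 (suc k) = m*n≢0 (threshold k) (limit k) {{threshold≢0 k}} {{limit≢0 k}}

  cost≢0 : ∀ k → NonZero (cost k)
  cost≢0 zero    = _
  cost≢0 (suc k) = m*n≢0 (suc κ) _ {{_}} {{m*n≢0 ν _ {{ν≢0}} {{m*n≢0 ν _ {{ν≢0}} {{m*n≢0 (cost k) γ {{cost≢0 k}}}}}}}}

  all-edges : Region → List (V × V)
  all-edges B = cartesianProduct (members B) (members B)

  short-walk : ∀ {B H u v ℓ} → ℓ ≤ 1 → Within (Inside B) u v ℓ → ((u , v) ∈ H ⊎ u ≡ v) → Within (Span H) u v (ℓ + 0)
  short-walk _ here _ = here
  short-walk _ (step _ _) (inj₂ refl) = here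
  short-walk (s≤s z≤n) (step (_ , _ , adj) p) (inj₁ i) with within-0 p
  ... | refl = step (adj , inj₁ i) here

  all-edges-short : ∀ {B u v ℓ} → GeoIn B u v ℓ → ℓ ≤ 1 → Within (Span (all-edges B)) u v (ℓ + 0)
  all-edges-short (here , _) _ = here
  all-edges-short {B} (p@(step (u∈ , _) _) , _) ℓ≤1 =
    short-walk ℓ≤1 p (inj₁ (∈-cartesianProduct⁺ (∈-members {B} u∈) (∈-members {B} (within-∈ u∈ p))))

  -- At distance at most 1 an edge serves its own ends. If `B` has at least `σ` vertices the
  -- demanded pairs are affordable; otherwise all pairs of members number at most `size B * σ`.
  pairwise-base : Pairwise 1 0 (σ * σ) 1
  pairwise-base B P with σ ≤? size B
  ... | yes σ≤n = P , bound , λ i g ℓ≤1 → short-walk ℓ≤1 (proj₁ g) (inj₁ i)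
    where
    open ≤-Reasoning
    bound : σ * σ * length P ≤ 1 * (size B * (σ * (σ * σ + length P)))
    bound = begin
      σ * σ * length P                            ≡⟨ *-assoc σ σ (length P) ⟩
      σ * (σ * length P)                          ≤⟨ *-mono-≤ σ≤n (*-monoʳ-≤ σ (m≤n+m (length P) (σ * σ))) ⟩
      size B * (σ * (σ * σ + length P))           ≡⟨ sym (*-identityˡ _) ⟩
      1 * (size B * (σ * (σ * σ + length P)))     ∎
  ... | no σ≰n = all-edges B , bound , λ _ → all-edges-short
    where
    open ≤-Reasoning
    e : ∀ s n → s * s * (n * n) ≡ n * (s * (s * n))
    e = solve-∀
    bound : σ * σ * length (all-edges B) ≤ 1 * (size B * (σ * (σ * σ + length P)))
    bound = begin
      σ * σ * length (all-edges B)                ≡⟨ cong (σ * σ *_) (length-cartesianProduct (members B) (members B)) ⟩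
      σ * σ * (size B * size B)                   ≡⟨ e σ (size B) ⟩
      size B * (σ * (σ * size B))                 ≤⟨ *-monoʳ-≤ (size B) (*-monoʳ-≤ σ (≤-trans (*-monoʳ-≤ σ (<⇒≤ (≰⇒> σ≰n))) (m≤m+n (σ * σ) (length P)))) ⟩
      size B * (σ * (σ * σ + length P))           ≡⟨ sym (*-identityˡ _) ⟩
      1 * (size B * (σ * (σ * σ + length P)))     ∎

  allPairs-base : AllPairs 1 0 σ 1
  allPairs-base B n≤σ = all-edges B , bound , all-edges-short
    where
    bound : length (all-edges B) ≤ 1 * (size B * σ)
    bound = ≤-trans (≤-reflexive (length-cartesianProduct (members B) (members B)))
                    (≤-trans (*-monoʳ-≤ (size B) n≤σ) (≤-reflexive (sym (*-identityˡ _))))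

  pairwise : ∀ k → Pairwise (r ^ k) (err k) (threshold k) (cost k)
  pairwise zero    = pairwise-base
  pairwise (suc k) = pairwise-step {r = r} {{m^n≢0 r k}} {{threshold≢0 k}} {{cost≢0 k}} (pairwise k)

  allPairs : ∀ k → AllPairs (r ^ k) (err k) (limit k) (cost k)
  allPairs zero    = allPairs-base
  allPairs (suc k) = allPairs-step {r = r} {{m^n≢0 r k}} {{threshold≢0 k}} {{cost≢0 k}} (pairwise k) (limit k) {{limit≢0 k}} (allPairs k)

  threshold≡ : ∀ k → threshold k ≡ σ ^ (2 ^ suc k)
  threshold≡ zero    = cong (σ *_) (sym (*-identityʳ σ))
  threshold≡ (suc k) = begin
    threshold k * threshold k                     ≡⟨ cong₂ _*_ (threshold≡ k) (threshold≡ k) ⟩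
    σ ^ (2 ^ suc k) * σ ^ (2 ^ suc k)             ≡⟨ sym (^-distribˡ-+-* σ (2 ^ suc k) (2 ^ suc k)) ⟩
    σ ^ (2 ^ suc k + 2 ^ suc k)                   ≡⟨ cong (λ n → σ ^ (2 ^ suc k + n)) (sym (+-identityʳ (2 ^ suc k))) ⟩
    σ ^ (2 ^ suc (suc k))                         ∎
    where open ≡-Reasoning

  -- Multiplied by `σ`, the recursion of `limit` becomes that of `threshold`; this postpones the
  -- truncated subtraction in the exponent.
  limit*σ : ∀ k → limit k * σ ≡ threshold k
  limit*σ zero    = refl
  limit*σ (suc k) = trans (*-assoc (threshold k) (limit k) σ) (cong (threshold k *_) (limit*σ k))

  limit≡ : ∀ k → limit k ≡ σ ^ (2 ^ suc k ∸ 1)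
  limit≡ k = *-cancelʳ-≡ _ _ σ (begin
    limit k * σ                        ≡⟨ trans (limit*σ k) (threshold≡ k) ⟩
    σ ^ (2 ^ suc k)                    ≡⟨ cong (σ ^_) (sym (m∸n+n≡m (m^n>0 2 (suc k)))) ⟩
    σ ^ (2 ^ suc k ∸ 1 + 1)            ≡⟨ ^-distribˡ-+-* σ (2 ^ suc k ∸ 1) 1 ⟩
    σ ^ (2 ^ suc k ∸ 1) * (σ * 1)      ≡⟨ cong (σ ^ (2 ^ suc k ∸ 1) *_) (*-identityʳ σ) ⟩
    σ ^ (2 ^ suc k ∸ 1) * σ            ∎)
    where open ≡-Reasoning

  cost≡ : ∀ k → cost k ≡ (suc κ * γ) ^ k * ν ^ (k + k)
  cost≡ zero    = refl
  cost≡ (suc k) = begin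
    suc κ * (ν * (ν * (cost k * γ)))                               ≡⟨ cong (λ c → suc κ * (ν * (ν * (c * γ)))) (cost≡ k) ⟩
    suc κ * (ν * (ν * ((suc κ * γ) ^ k * ν ^ (k + k) * γ)))        ≡⟨ e (suc κ) ν γ ((suc κ * γ) ^ k) (ν ^ (k + k)) ⟩
    suc κ * γ * (suc κ * γ) ^ k * (ν * (ν * ν ^ (k + k)))          ≡⟨ cong (λ n → (suc κ * γ) ^ suc k * (ν * ν ^ n)) (sym (+-suc k k)) ⟩
    (suc κ * γ) ^ suc k * ν ^ (suc k + suc k)                      ∎
    where
    open ≡-Reasoning
    e : ∀ a n g p q → a * (n * (n * (p * q * g))) ≡ a * g * p * (n * (n * q))
    e = solve-∀

  abstract
    -- Level k+1 is applied to the whole vertex set, whose size the hypothesis bounds by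
    -- `limit (suc k)`.
    scale-spanner : ∀ k → N ≤ σ ^ (2 ^ suc (suc k) ∸ 1) → ∃ λ H →
      length H ≤ (suc κ * γ) ^ suc k * ν ^ (suc k + suc k) * (N * σ) ×
      (∀ {u v ℓ} → Geo {E = Adj G} u v ℓ → ℓ ≤ r ^ suc k → Within (Span H) u v (ℓ + stretch (suc k) * r ^ k))
    scale-spanner k N≤σ^ =
      let H , |H|≤ , reach = allPairs (suc k) whole (≤-trans size-whole (≤-trans N≤σ^ (≤-reflexive (sym (limit≡ (suc k)))))) in
      H , ≤-trans |H|≤ (*-mono-≤ (≤-reflexive (cost≡ (suc k))) (*-monoˡ-≤ σ size-whole)) ,
      λ {_} {_} {ℓ} g ℓ≤ → weaken (+-monoʳ-≤ ℓ (err-suc≤ k)) (reach (geo-whole g) ℓ≤)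
      where
      whole : Region
      whole _ = true
      size-whole : size whole ≤ N
      size-whole = ≤-trans (List.length-filter (T? ∘ whole) (allFin N)) (≤-reflexive (List.length-tabulate {n = N} id))
      geo-whole : ∀ {u v ℓ} → Geo {E = Adj G} u v ℓ → GeoIn whole u v ℓ
      geo-whole (p , min) = within-map (λ e → tt , tt , e) p , λ q → min (within-map (proj₂ ∘ proj₂) q)

-- Distances, edge counts and the choice of a scale

module Walks {N : ℕ} (G : Graph N) where

  walk⇒within : ∀ {s t} (w : Walk G s t) → Within (Adj G) s t (∣_∣ʷ {G = G} w)
  walk⇒within ε       = here
  walk⇒within (e ◅ w) = step e (walk⇒within w)

  within⇒walk : ∀ {s t n} → Within (Adj G) s t n → ∃ λ (w : Walk G s t) → ∣_∣ʷ {G = G} w ≤ n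
  within⇒walk here       = ε , z≤n
  within⇒walk (step e p) = let w , |w|≤n = within⇒walk p in e ◅ w , s≤s |w|≤n

  dist⇒geo : ∀ {s t d} → Dist G s t d → Geo {E = Adj G} s t d
  dist⇒geo {s} {t} ((w , |w|≡d) , min) = subst (Within (Adj G) s t) |w|≡d (walk⇒within w) ,
    λ p → let w′ , |w′|≤n = within⇒walk p in ≤-trans (min w′) |w′|≤n

  geo⇒dist : ∀ {s t d} → Geo {E = Adj G} s t d → Dist G s t d
  geo⇒dist (p , min) = let w , |w|≤d = within⇒walk p in
    (w , ≤-antisym |w|≤d (min (walk⇒within w))) , λ w′ → min (walk⇒within w′)

  -- The vertices at positions 0 to `d` of a geodesic have different distances from `s`, so they are
  -- distinct.
  geo-length : ∀ {s t d} → Geo {E = Adj G} s t d → suc d ≤ N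
  geo-length {s} {t} {d} g = Fin.injective⇒≤ {f = vertex} injective
    where
    vertices : ∀ i → i ≤ d → ∃ λ w → Geo {E = Adj G} s w i
    vertices i i≤d with m≤n⇒∃[o]m+o≡n i≤d
    ... | j , eq with subst (Geo s t) (sym eq) g
    ...   | g′ with split i (proj₁ g′)
    ...     | w , p , q = w , geo-prefix g′ p q
    vertex : Fin (suc d) → Fin N
    vertex i = proj₁ (vertices (toℕ i) (≤-pred (Fin.toℕ<n i)))
    injective : ∀ {i j} → vertex i ≡ vertex j → i ≡ j
    injective {i} {j} eq = Fin.toℕ-injective (geo-unique
      (proj₂ (vertices (toℕ i) (≤-pred (Fin.toℕ<n i)))) (subst (λ w → Geo s w (toℕ j)) (sym eq) (proj₂ (vertices (toℕ j) (≤-pred (Fin.toℕ<n j))))))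

module Spanner {N : ℕ} (G : Graph N) (H : List (Fin N × Fin N)) where

  open Spanners G

  spanner : Graph N
  spanner = record
    { Adj        = Span H
    ; Adj-sym    = span-sym H
    ; Adj-irrefl = λ v (e , _) → Adj-irrefl G v e
    ; Adj?       = λ u v → Adj? G u v ×-dec ((u , v) ∈? H ⊎-dec (v , u) ∈? H)
    }
    where open DecMembership (≡-dec (Fin._≟_ {N}) Fin._≟_) using (_∈?_)

  -- `edges` lists no pair twice, and each listed pair or its reversal is in `H`; the factor 2 pays
  -- for both orientations.
  spanner-edges : ∣E spanner ∣ ≤ 2 * length H
  spanner-edges = begin
    ∣E spanner ∣                          ≤⟨ unique-⊆-length (Unique.filter⁺ edge? {xs = pairs} (Unique.cartesianProduct⁺ (Unique.allFin⁺ N) (Unique.allFin⁺ N))) edges⊆ ⟩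
    length (H ++ map swap H)              ≡⟨ List.length-++ H ⟩
    length H + length (map swap H)        ≡⟨ cong (length H +_) (trans (List.length-map swap H) (sym (+-identityʳ _))) ⟩
    2 * length H                          ∎
    where
    open ≤-Reasoning
    pairs = cartesianProduct (allFin N) (allFin N)
    edge? : ∀ e → Dec _
    edge? = λ (u , v) → (u Fin.<? v) ×-dec Adj? spanner u v
    edges⊆ : edges spanner ⊆ᴸ H ++ map swap H
    edges⊆ e∈ with ∈-filter⁻ edge? {xs = pairs} e∈
    ... | _ , _ , _ , inj₁ i = ∈-++⁺ˡ i
    ... | _ , _ , _ , inj₂ i = ∈-++⁺ʳ H (∈-map⁺ swap i)

^-distribʳ-* : ∀ n a b → (a * b) ^ n ≡ a ^ n * b ^ n
^-distribʳ-* zero    a b = refl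
^-distribʳ-* (suc n) a b = trans (cong (a * b *_) (^-distribʳ-* n a b)) (e a b (a ^ n) (b ^ n))
  where
  e : ∀ a b c d → a * b * (c * d) ≡ a * c * (b * d)
  e = solve-∀

-- The exponent `a` is the least with d ≤ r^(k+1) for r = 2^a. By minimality r/2 is below the
-- (k+1)-th root of `d`, unless r = 1, so r^k is at most 2^k d^(k/(k+1)); this is stated as a
-- (k+1)-th power.
scale : ∀ k m d → 0 < d → d ≤ (2 ^ m) ^ suc k →
        ∃ λ a → a ≤ m × d ≤ (2 ^ a) ^ suc k × ((2 ^ a) ^ k) ^ suc k ≤ (2 ^ k) ^ suc k * d ^ k
scale k zero d 0<d d≤ = 0 , z≤n , d≤ , (begin
  (1 ^ k) ^ suc k              ≡⟨ trans (cong (_^ suc k) (^-zeroˡ k)) (^-zeroˡ (suc k)) ⟩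
  1                            ≤⟨ *-mono-≤ (m^n>0 (2 ^ k) {{m^n≢0 2 k}} (suc k)) (m^n>0 d {{>-nonZero 0<d}} k) ⟩
  (2 ^ k) ^ suc k * d ^ k      ∎)
  where open ≤-Reasoning
scale k (suc m) d 0<d d≤ with d ≤? (2 ^ m) ^ suc k
... | yes d≤′ = let a , a≤m , rest = scale k m d 0<d d≤′ in a , m≤n⇒m≤1+n a≤m , rest
... | no d≰   = suc m , ≤-refl , d≤ , (begin
  ((2 * 2 ^ m) ^ k) ^ suc k                    ≡⟨ cong (_^ suc k) (^-distribʳ-* k 2 (2 ^ m)) ⟩
  (2 ^ k * (2 ^ m) ^ k) ^ suc k                ≡⟨ ^-distribʳ-* (suc k) (2 ^ k) _ ⟩
  (2 ^ k) ^ suc k * ((2 ^ m) ^ k) ^ suc k      ≡⟨ cong ((2 ^ k) ^ suc k *_) (trans (^-*-assoc (2 ^ m) k (suc k))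
                                                    (trans (cong ((2 ^ m) ^_) (*-comm k (suc k))) (sym (^-*-assoc (2 ^ m) (suc k) k)))) ⟩
  (2 ^ k) ^ suc k * ((2 ^ m) ^ suc k) ^ k      ≤⟨ *-monoʳ-≤ ((2 ^ k) ^ suc k) (^-monoˡ-≤ k (<⇒≤ (≰⇒> d≰))) ⟩
  (2 ^ k) ^ suc k * d ^ k                      ∎)
  where open ≤-Reasoning

-- All scales

n≤2^n : ∀ n → n ≤ 2 ^ n
n≤2^n zero    = z≤n
n≤2^n (suc n) = begin
  1 + n              ≤⟨ +-mono-≤ (m^n>0 2 n) (n≤2^n n) ⟩
  2 ^ n + 2 ^ n      ≡⟨ cong (2 ^ n +_) (sym (+-identityʳ (2 ^ n))) ⟩
  2 ^ suc n          ∎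
  where open ≤-Reasoning

within⇒dist : ∀ {N} (S : Graph N) {s t n} → Within (Adj S) s t n → ∃ λ d → Dist S s t d × d ≤ n
within⇒dist S p = let d , d≤n , g = geodesic (within-dec (Adj? S)) p in d , Walks.geo⇒dist S g , d≤n

dist-0 : ∀ {N} (G S : Graph N) {s t} → Dist G s t 0 → Dist S s t 0
dist-0 G S {s} dist = subst (λ t → Dist S s t 0) (within-0 (proj₁ (Walks.dist⇒geo G dist)))
                            (Walks.geo⇒dist S (here , λ _ → z≤n))

module _ {N : ℕ} (G : Graph N) (κ ν : ℕ) .{{ν≢0 : NonZero ν}} (N≤ν^κ : N ≤ ν ^ κ)
         (σ : ℕ) .{{σ≢0 : NonZero σ}} (k : ℕ) (N≤σ^ : N ≤ σ ^ (2 ^ suc (suc k) ∸ 1)) where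

  open Spanners G
  open Walks G
  open Constants κ

  private
    at-scale : ∀ a → ∃ λ H →
      length H ≤ (suc κ * γ) ^ suc k * ν ^ (suc k + suc k) * (N * σ) ×
      (∀ {u v ℓ} → Geo {E = Adj G} u v ℓ → ℓ ≤ (2 ^ a) ^ suc k → Within (Span H) u v (ℓ + stretch (suc k) * (2 ^ a) ^ k))
    at-scale a = Iteration.scale-spanner G κ ν N≤ν^κ σ (2 ^ a) {{m^n≢0 2 a}} k N≤σ^

    -- The exponents up to `ν * κ` suffice because `N ≤ 2 ^ (ν * κ)`. This crude substitute for a
    -- logarithm costs one further factor of order `ν`.
    scales : List ℕ
    scales = upTo (suc (ν * κ))

    H : List (V × V)
    H = concatMap (proj₁ ∘ at-scale) scales

    N≤2^ : N ≤ 2 ^ (ν * κ)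
    N≤2^ = begin
      N                ≤⟨ N≤ν^κ ⟩
      ν ^ κ            ≤⟨ ^-monoˡ-≤ κ (n≤2^n ν) ⟩
      (2 ^ ν) ^ κ      ≡⟨ ^-*-assoc 2 ν κ ⟩
      2 ^ (ν * κ)      ∎
      where open ≤-Reasoning

    |H|≤ : length H ≤ suc (ν * κ) * ((suc κ * γ) ^ suc k * ν ^ (suc k + suc k) * (N * σ))
    |H|≤ = begin
      length H                                                     ≡⟨ length-concatMap (proj₁ ∘ at-scale) scales ⟩
      ∑ (length ∘ proj₁ ∘ at-scale) scales                         ≤⟨ ∑-mono (proj₁ ∘ proj₂ ∘ at-scale) scales ⟩
      ∑ (λ _ → (suc κ * γ) ^ suc k * ν ^ (suc k + suc k) * (N * σ)) scales
        ≡⟨ trans (∑-const _ scales) (cong (_* ((suc κ * γ) ^ suc k * ν ^ (suc k + suc k) * (N * σ))) (List.length-upTo (suc (ν * κ)))) ⟩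
      suc (ν * κ) * ((suc κ * γ) ^ suc k * ν ^ (suc k + suc k) * (N * σ)) ∎
      where open ≤-Reasoning

    reach : ∀ {s t d} → 0 < d → Geo {E = Adj G} s t d → ∃ λ c → Within (Span H) s t (d + c)
              × c ^ suc k ≤ (stretch (suc k) * 2 ^ k) ^ suc k * d ^ k
    reach {s} {t} {d} 0<d g with scale k (ν * κ) d 0<d (begin
        d                            ≤⟨ <⇒≤ (geo-length g) ⟩
        N                            ≤⟨ N≤2^ ⟩
        2 ^ (ν * κ)                  ≤⟨ m≤m*n _ _ {{m^n≢0 (2 ^ (ν * κ)) k {{m^n≢0 2 (ν * κ)}}}} ⟩
        (2 ^ (ν * κ)) ^ suc k        ∎)
      where open ≤-Reasoning
    ... | a , a≤ , d≤ , r^≤ = stretch (suc k) * (2 ^ a) ^ k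
        , span-mono (λ i → ∈-concatMap⁺ (proj₁ ∘ at-scale) (lose (∈-upTo⁺ (s≤s a≤)) i)) (proj₂ (proj₂ (at-scale a)) g d≤)
        , (begin
        (stretch (suc k) * (2 ^ a) ^ k) ^ suc k                      ≡⟨ ^-distribʳ-* (suc k) (stretch (suc k)) _ ⟩
        stretch (suc k) ^ suc k * ((2 ^ a) ^ k) ^ suc k              ≤⟨ *-monoʳ-≤ (stretch (suc k) ^ suc k) r^≤ ⟩
        stretch (suc k) ^ suc k * ((2 ^ k) ^ suc k * d ^ k)          ≡⟨ sym (*-assoc (stretch (suc k) ^ suc k) ((2 ^ k) ^ suc k) (d ^ k)) ⟩
        stretch (suc k) ^ suc k * (2 ^ k) ^ suc k * d ^ k            ≡⟨ cong (_* d ^ k) (sym (^-distribʳ-* (suc k) (stretch (suc k)) (2 ^ k))) ⟩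
        (stretch (suc k) * 2 ^ k) ^ suc k * d ^ k                    ∎)
      where open ≤-Reasoning

  sublinear-spanner : ∃ λ (S : Graph N) → S ⊆ G
    × ∣E S ∣ ≤ 2 * (suc (ν * κ) * ((suc κ * γ) ^ suc k * ν ^ (suc k + suc k) * (N * σ)))
    × (∀ s t d → Dist G s t d → ∃ λ d′ → Dist S s t d′ × (d′ ∸ d) ^ suc k ≤ (stretch (suc k) * 2 ^ k) ^ suc k * d ^ k)
  sublinear-spanner = spanner , proj₁ , ≤-trans spanner-edges (*-monoʳ-≤ 2 |H|≤) , distances
    where
    open Spanner G H
    distances : ∀ s t d → Dist G s t d → ∃ λ d′ → Dist spanner s t d′ × (d′ ∸ d) ^ suc k ≤ (stretch (suc k) * 2 ^ k) ^ suc k * d ^ k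
    -- Distance 0 is treated apart, since `scale` requires a positive distance; no error arises
    -- here.
    distances s t zero    dist = 0 , dist-0 G spanner dist , z≤n
    distances s t (suc d) dist =
      let c , p , c^≤ = reach (s≤s z≤n) (dist⇒geo dist)
          d′ , dist′ , d′≤ = within⇒dist spanner p in
      d′ , dist′ , ≤-trans (^-monoˡ-≤ (suc k) (≤-trans (∸-monoˡ-≤ (suc d) d′≤) (≤-reflexive (m+n∸m≡n (suc d) c)))) c^≤

-- Exponents

open import Data.Integer using (+_)

-- Going from `n` to n+1 raises the root by one only when its power falls short, and then ν+1 ≤ 2ν
-- keeps the overshoot within 2^κ.
root : ∀ κ .{{_ : NonZero κ}} n → 0 < n → ∃ λ ν → 0 < ν × n ≤ ν ^ κ × ν ^ κ ≤ 2 ^ κ * n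
root κ (suc zero) _ = 1 , s≤s z≤n , ≤-reflexive (sym (^-zeroˡ κ)) ,
  ≤-trans (≤-reflexive (^-zeroˡ κ)) (*-mono-≤ (m^n>0 2 κ) ≤-refl)
root κ (suc n@(suc _)) _ with root κ n (s≤s z≤n)
... | ν , 0<ν , n≤ , ≤2n with suc n ≤? ν ^ κ
...   | yes ok = ν , 0<ν , ok , ≤-trans ≤2n (*-monoʳ-≤ (2 ^ κ) (n≤1+n n))
...   | no ¬ok = suc ν , s≤s z≤n , ≤-trans (s≤s n≤) (^-monoˡ-< κ ≤-refl) , (begin
  suc ν ^ κ          ≤⟨ ^-monoˡ-≤ κ (+-mono-≤ 0<ν (m≤m+n ν 0)) ⟩
  (2 * ν) ^ κ        ≡⟨ ^-distribʳ-* κ 2 ν ⟩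
  2 ^ κ * ν ^ κ      ≤⟨ *-monoʳ-≤ (2 ^ κ) (<⇒≤ (≰⇒> ¬ok)) ⟩
  2 ^ κ * suc n      ∎)
  where open ≤-Reasoning

^-cancelˡ-≤ : ∀ x .{{_ : NonZero x}} {a b} → a ^ x ≤ b ^ x → a ≤ b
^-cancelˡ-≤ x {a} {b} a^≤b^ with a ≤? b
... | yes a≤b = a≤b
... | no a≰b = contradiction a^≤b^ (<⇒≱ (^-monoˡ-< x (≰⇒> a≰b)))

-- Up to constants `ν` is the κ-th and `σ` the M-th root of `n`, so the size has exponent s/κ + 1 +
-- 1/M; the power κM clears the denominators.
size-exponent : ∀ κ M s c e n ν σ → ν ^ κ ≤ 2 ^ κ * n → σ ^ M ≤ 2 ^ M * n → e ≤ c * (ν ^ s * (n * σ)) →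
  e ^ (κ * M) ≤ (c * (2 ^ s * 2)) ^ (κ * M) * n ^ (s * M + (κ * M + κ))
size-exponent κ M s c e n ν σ ν≤ σ≤ e≤ = begin
  e ^ x                                                       ≤⟨ ^-monoˡ-≤ x e≤ ⟩
  (c * (ν ^ s * (n * σ))) ^ x                                 ≡⟨ trans (^-distribʳ-* x c _) (cong (c ^ x *_) (trans (^-distribʳ-* x (ν ^ s) _) (cong ((ν ^ s) ^ x *_) (^-distribʳ-* x n σ)))) ⟩
  c ^ x * ((ν ^ s) ^ x * (n ^ x * σ ^ x))                     ≤⟨ *-monoʳ-≤ (c ^ x) (*-mono-≤ ν-part (*-monoʳ-≤ (n ^ x) σ-part)) ⟩
  c ^ x * ((2 ^ s) ^ x * n ^ (s * M) * (n ^ x * (2 ^ x * n ^ κ))) ≡⟨ eq (c ^ x) ((2 ^ s) ^ x) (n ^ (s * M)) (n ^ x) (2 ^ x) (n ^ κ) ⟩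
  c ^ x * ((2 ^ s) ^ x * 2 ^ x) * (n ^ (s * M) * (n ^ x * n ^ κ))
    ≡⟨ cong₂ _*_ (trans (cong (c ^ x *_) (sym (^-distribʳ-* x (2 ^ s) 2))) (sym (^-distribʳ-* x c _)))
                 (trans (cong (n ^ (s * M) *_) (sym (^-distribˡ-+-* n x κ))) (sym (^-distribˡ-+-* n (s * M) (x + κ)))) ⟩
  (c * (2 ^ s * 2)) ^ x * n ^ (s * M + (x + κ))               ∎
  where
  open ≤-Reasoning
  x = κ * M
  eq : ∀ a b c d e f → a * (b * c * (d * (e * f))) ≡ a * (b * e) * (c * (d * f))
  eq = solve-∀
  κ[sM]≡s[κM] : κ * (s * M) ≡ s * (κ * M)
  κ[sM]≡s[κM] = comm κ s M
    where
    comm : ∀ a b c → a * (b * c) ≡ b * (a * c)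
    comm = solve-∀
  regroup : ∀ b → (b ^ s) ^ x ≡ (b ^ κ) ^ (s * M)
  regroup b = trans (^-*-assoc b s x) (trans (cong (b ^_) (sym κ[sM]≡s[κM])) (sym (^-*-assoc b κ (s * M))))
  regroup′ : ∀ b → b ^ x ≡ (b ^ M) ^ κ
  regroup′ b = trans (cong (b ^_) (*-comm κ M)) (sym (^-*-assoc b M κ))
  ν-part : (ν ^ s) ^ x ≤ (2 ^ s) ^ x * n ^ (s * M)
  ν-part = begin
    (ν ^ s) ^ x                               ≡⟨ regroup ν ⟩
    (ν ^ κ) ^ (s * M)                         ≤⟨ ^-monoˡ-≤ (s * M) ν≤ ⟩
    (2 ^ κ * n) ^ (s * M)                     ≡⟨ ^-distribʳ-* (s * M) (2 ^ κ) n ⟩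
    (2 ^ κ) ^ (s * M) * n ^ (s * M)           ≡⟨ cong (_* n ^ (s * M)) (sym (regroup 2)) ⟩
    (2 ^ s) ^ x * n ^ (s * M)                 ∎
  σ-part : σ ^ x ≤ 2 ^ x * n ^ κ
  σ-part = begin
    σ ^ x                                     ≡⟨ regroup′ σ ⟩
    (σ ^ M) ^ κ                               ≤⟨ ^-monoˡ-≤ κ σ≤ ⟩
    (2 ^ M * n) ^ κ                           ≡⟨ ^-distribʳ-* κ (2 ^ M) n ⟩
    (2 ^ M) ^ κ * n ^ κ                       ≡⟨ cong (_* n ^ κ) (sym (regroup′ 2)) ⟩
    2 ^ x * n ^ κ                             ∎

-- The hypothesis on products says y/x ≤ p/b. Both sides are compared after raising to the x-th
-- power, where all exponents are integers.
change-exponent : ∀ x .{{_ : NonZero x}} y b p {a e n} .{{_ : NonZero n}} → e ^ x ≤ a ^ x * n ^ y → y * b ≤ p * x →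
                  e ^ b ≤ a ^ b * n ^ p
change-exponent x y b p {a} {e} {n} e^≤ yb≤px = ^-cancelˡ-≤ x (begin
  (e ^ b) ^ x                      ≡⟨ exchange e ⟩
  (e ^ x) ^ b                      ≤⟨ ^-monoˡ-≤ b e^≤ ⟩
  (a ^ x * n ^ y) ^ b              ≡⟨ ^-distribʳ-* b (a ^ x) (n ^ y) ⟩
  (a ^ x) ^ b * (n ^ y) ^ b        ≡⟨ cong₂ _*_ (sym (exchange a)) (^-*-assoc n y b) ⟩
  (a ^ b) ^ x * n ^ (y * b)        ≤⟨ *-monoʳ-≤ ((a ^ b) ^ x) (^-monoʳ-≤ n yb≤px) ⟩
  (a ^ b) ^ x * n ^ (p * x)        ≡⟨ cong ((a ^ b) ^ x *_) (sym (^-*-assoc n p x)) ⟩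
  (a ^ b) ^ x * (n ^ p) ^ x        ≡⟨ sym (^-distribʳ-* x (a ^ b) (n ^ p)) ⟩
  (a ^ b * n ^ p) ^ x              ∎)
  where
  open ≤-Reasoning
  exchange : ∀ c → (c ^ b) ^ x ≡ (c ^ x) ^ b
  exchange c = trans (^-*-assoc c b x) (trans (cong (c ^_) (*-comm b x)) (sym (^-*-assoc c x b)))

-- If `u ≤ l`, rounding `u` down inside the upper cut puts `l` into it too, against disjointness.
lower<upper : ∀ (x : ℝ) {l u} → l <ᴿ x → x ᴿ< u → l ℚ.< u
lower<upper x {l} {u} l<x x<u with ℚ._<?_ l u
... | yes l<u = l<u
... | no l≮u with Equivalence.to (upper-rounded x u) x<u
...   | u′ , u′<u , x<u′ = contradiction (l<x , Equivalence.from (upper-rounded x l) (u′ , ℚ.<-≤-trans u′<u (ℚ.≮⇒≥ l≮u) , x<u′)) (disjoint x l)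

upper-/ : ∀ x m .{{_ : NonZero m}} {q} → x /ᴿ m ᴿ< q → x ᴿ< q ℚ.* ((+ m) ℚ./ 1)
upper-/ x (suc m) x/m<q = x/m<q

-- An exponent q above 1 + (1 + δ)/M, in the form pMD ≥ b + (bM + b)D when q = p/b and δ > 1/D.
exponent-bound : ∀ {d D b M z} → mkℚᵘ (+ suc d) D ℚ.< ((mkℚᵘ z b ℚ.- 1ℚᵘ) ℚ.* ((+ M) ℚ./ 1)) ℚ.- 1ℚᵘ →
  ∃ λ p → z ≡ + p × suc b + (suc b * M + suc b) * suc D ≤ p * M * suc D
exponent-bound {d} {D} {b} {M} {z} (*<* lt) = from-sign z refl
  where
  b′ D′ M′ : ℤ
  b′  = + suc b
  D′ = + suc D
  M′ = + M
  u = ((mkℚᵘ z b ℚ.- 1ℚᵘ) ℚ.* ((+ M) ℚ./ 1)) ℚ.- 1ℚᵘ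
  den : ℚ.↧ u ≡ b′
  den = cong +_ (trans (*-identityʳ (suc b * 1 * 1)) (trans (*-identityʳ (suc b * 1)) (*-identityʳ (suc b))))
  num : ℚ.↥ u ≡ (z ℤ.- b′) ℤ.* M′ ℤ.- b′
  num = trans (cong (λ e → (z ℤ.* ℤ.1ℤ ℤ.+ ℤ.-1ℤ ℤ.* b′) ℤ.* M′ ℤ.* ℤ.1ℤ ℤ.+ ℤ.-1ℤ ℤ.* e)
                    (cong +_ (trans (*-identityʳ (suc b * 1)) (*-identityʳ (suc b)))))
              (e z b′ M′)
    where
    e : ∀ z b′ M → (z ℤ.* ℤ.1ℤ ℤ.+ ℤ.-1ℤ ℤ.* b′) ℤ.* M ℤ.* ℤ.1ℤ ℤ.+ ℤ.-1ℤ ℤ.* b′ ≡ (z ℤ.- b′) ℤ.* M ℤ.- b′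
    e = ℤ-Solver.solve-∀
  lt′ : + suc d ℤ.* b′ ℤ.< ((z ℤ.- b′) ℤ.* M′ ℤ.- b′) ℤ.* D′
  lt′ = subst₂ (λ n e → + suc d ℤ.* e ℤ.< n ℤ.* D′) num den lt
  W = (b′ ℤ.* M′ ℤ.+ b′) ℤ.* D′
  lt″ : + suc d ℤ.* b′ ℤ.+ W ℤ.< z ℤ.* M′ ℤ.* D′
  lt″ = subst (+ suc d ℤ.* b′ ℤ.+ W ℤ.<_) (e z b′ M′ D′) (ℤ.+-monoˡ-< W lt′)
    where
    e : ∀ z b′ M D → ((z ℤ.- b′) ℤ.* M ℤ.- b′) ℤ.* D ℤ.+ (b′ ℤ.* M ℤ.+ b′) ℤ.* D ≡ z ℤ.* M ℤ.* D
    e = ℤ-Solver.solve-∀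
  lhs : + suc d ℤ.* b′ ℤ.+ W ≡ + (suc d * suc b + (suc b * M + suc b) * suc D)
  lhs = trans (cong₂ ℤ._+_ (sym (ℤ.pos-* (suc d) (suc b)))
          (trans (cong (ℤ._* D′) (trans (cong (ℤ._+ b′) (sym (ℤ.pos-* (suc b) M))) (sym (ℤ.pos-+ (suc b * M) (suc b)))))
                 (sym (ℤ.pos-* (suc b * M + suc b) (suc D)))))
        (sym (ℤ.pos-+ (suc d * suc b) ((suc b * M + suc b) * suc D)))
  from-sign : ∀ z′ → z ≡ z′ → ∃ λ p → z ≡ + p × suc b + (suc b * M + suc b) * suc D ≤ p * M * suc D
  from-sign (+ p) z≡ = p , z≡ , (begin
    suc b + (suc b * M + suc b) * suc D           ≤⟨ +-monoˡ-≤ _ (m≤n*m (suc b) (suc d)) ⟩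
    suc d * suc b + (suc b * M + suc b) * suc D   ≤⟨ <⇒≤ (ℤ.drop‿+<+ (subst₂ ℤ._<_ lhs rhs lt″)) ⟩
    p * M * suc D                                 ∎)
    where
    open ≤-Reasoning
    rhs : z ℤ.* M′ ℤ.* D′ ≡ + (p * M * suc D)
    rhs = trans (cong (λ z → z ℤ.* M′ ℤ.* D′) z≡) (trans (cong (ℤ._* D′) (sym (ℤ.pos-* p M))) (sym (ℤ.pos-* (p * M) (suc D))))
  -- A negative `q` would make the right side of `lt″` nonpositive, while its left side is a natural
  -- number.
  from-sign (-[1+ p ]) z≡ = contradiction (subst (ℤ._< z ℤ.* M′ ℤ.* D′) lhs lt″)
    (ℤ.≤⇒≯ (ℤ.≤-trans (subst (λ z → z ℤ.* M′ ℤ.* D′ ℤ.≤ ℤ.0ℤ) (sym z≡) nonpos) (ℤ.+≤+ z≤n)))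
    where
    e : ∀ p M D → (ℤ.- p) ℤ.* M ℤ.* D ≡ ℤ.- (p ℤ.* M ℤ.* D)
    e = ℤ-Solver.solve-∀
    nonpos : -[1+ p ] ℤ.* M′ ℤ.* D′ ℤ.≤ ℤ.0ℤ
    nonpos = subst (ℤ._≤ ℤ.0ℤ) (sym (trans (e (+ suc p) M′ D′) (cong ℤ.-_
      (trans (cong (ℤ._* D′) (sym (ℤ.pos-* (suc p) M))) (sym (ℤ.pos-* (suc p * M) (suc D))))))) (neg≤ _)
      where
      neg≤ : ∀ n → ℤ.- (+ n) ℤ.≤ ℤ.0ℤ
      neg≤ zero    = ℤ.≤-refl
      neg≤ (suc n) = ℤ.-≤+

positive-numerator : ∀ {z D} → 0ℚᵘ ℚ.< mkℚᵘ z D → ∃ λ m → z ≡ + suc m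
positive-numerator {+ suc m}   _        = m , refl
positive-numerator {+ zero}    (*<* lt) = contradiction lt (ℤ.<-irrefl refl)
positive-numerator { -[1+ n ]} (*<* ())

-- With M = 2^(k+1) - 1, the choice of `κ` makes the loss s/κ equal to 1/(M(D+1)), which is less
-- than δ/M. So s/κ + 1 + 1/M lies below every rational `q` above the claimed exponent.
size-bound : ∀ δ k s {m D κ} → mkℚᵘ (+ suc m) D <ᴿ δ → κ ≡ (2 ^ suc k ∸ 1) * s * suc D →
  .{{_ : NonZero (κ * (2 ^ suc k ∸ 1))}} → ∀ {a e n} .{{_ : NonZero n}} →
  e ^ (κ * (2 ^ suc k ∸ 1)) ≤ a ^ (κ * (2 ^ suc k ∸ 1)) * n ^ (s * (2 ^ suc k ∸ 1) + (κ * (2 ^ suc k ∸ 1) + κ)) →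
  e ≤[ a · n ^ℝ 1+[1+ δ ]/[2^[1+ k ]∸1] ]
size-bound δ k s {m} {D} {κ} m/D<δ κ≡ {a} {e} {n} e≤ (mkℚᵘ z b) x<q =
  subst (λ z → e ≤[ a · n ^ℚ mkℚᵘ z b ]) (sym (proj₁ (proj₂ bound)))
    (change-exponent (κ * M) (s * M + (κ * M + κ)) (suc b) p e≤ y*b≤p*x)
  where
  M = 2 ^ suc k ∸ 1
  bound : ∃ λ p → z ≡ + p × suc b + (suc b * M + suc b) * suc D ≤ p * M * suc D
  bound = exponent-bound (lower<upper δ m/D<δ (upper-/ (1ℚᵘ +ᴿ δ) M {{2^[1+k]∸1-nonZero k}} x<q))
  p = proj₁ bound
  e₁ : ∀ s M b D → (s * M + (M * s * D * M + M * s * D)) * b ≡ s * M * (b + (b * M + b) * D)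
  e₁ = solve-∀
  e₂ : ∀ s M p D → s * M * (p * M * D) ≡ p * (M * s * D * M)
  e₂ = solve-∀
  open ≤-Reasoning
  y*b≤p*x : (s * M + (κ * M + κ)) * suc b ≤ p * (κ * M)
  y*b≤p*x = begin
    (s * M + (κ * M + κ)) * suc b                                    ≡⟨ cong (λ κ → (s * M + (κ * M + κ)) * suc b) κ≡ ⟩
    (s * M + (M * s * suc D * M + M * s * suc D)) * suc b            ≡⟨ e₁ s M (suc b) (suc D) ⟩
    s * M * (suc b + (suc b * M + suc b) * suc D)                    ≤⟨ *-monoʳ-≤ (s * M) (proj₂ (proj₂ bound)) ⟩
    s * M * (p * M * suc D)                                          ≡⟨ e₂ s M p (suc D) ⟩
    p * (M * s * suc D * M)                                          ≡⟨ cong (λ κ → p * (κ * M)) (sym κ≡) ⟩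
    p * (κ * M)                                                      ∎

empty-size : ∀ a x → 0 ≤[ a · 0 ^ℝ x ]
empty-size a x (mkℚᵘ (+ p)    b) _ = z≤n
empty-size a x (mkℚᵘ -[1+ p ] b) _ = z≤n

-- Choice of the parameters

module _ (δ : ℝ) (k : ℕ) {m D} (m/D<δ : mkℚᵘ (+ suc m) D <ᴿ δ) where

  private
    -- `s` counts the factors `ν` in the size: two for each of the k+1 levels and one for the number
    -- of scales.
    M s κ : ℕ
    M = 2 ^ suc (suc k) ∸ 1
    s = suc (suc k + suc k)
    κ = M * s * suc D

    M≢0 : NonZero M
    M≢0 = 2^[1+k]∸1-nonZero (suc k)

    κ≢0 : NonZero κ
    κ≢0 = m*n≢0 (M * s) (suc D) {{m*n≢0 M s {{M≢0}}}}

  open Constants κ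

  -- In `size-constant` the factor `2 ^ s * 2` comes from rounding the roots `ν` and `σ`, the rest
  -- from the cost over all scales.
  stretch-constant size-constant : ℕ
  stretch-constant = stretch (suc k) * 2 ^ k
  size-constant    = 2 * (suc κ * (suc κ * γ) ^ suc k) * (2 ^ s * 2)

  spanner-exists : ∀ n (G : Graph n) → ∃ λ H → H ⊆ G
    × (∣E H ∣ ≤[ size-constant · n ^ℝ 1+[1+ δ ]/[2^[1+ suc k ]∸1] ])
    × (∀ s t d → Dist G s t d → ∃ λ d′ → Dist H s t d′ × (d′ ∸ d) ^ suc k ≤ stretch-constant ^ suc k * d ^ k)
  spanner-exists zero      G = G , id , empty-size size-constant 1+[1+ δ ]/[2^[1+ suc k ]∸1] , λ ()
  spanner-exists n@(suc _) G =
    let ν , 0<ν , n≤ν^ , ν^≤ = root κ {{κ≢0}} n (s≤s z≤n)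
        σ , 0<σ , n≤σ^ , σ^≤ = root M {{M≢0}} n (s≤s z≤n)
        H , H⊆G , |H|≤ , distances = sublinear-spanner G κ ν {{>-nonZero 0<ν}} n≤ν^ σ {{>-nonZero 0<σ}} k n≤σ^
    in H , H⊆G
     , size-bound δ (suc k) s m/D<δ refl {{m*n≢0 κ M {{κ≢0}} {{M≢0}}}}
         (size-exponent κ M s (2 * (suc κ * (suc κ * γ) ^ suc k)) ∣E H ∣ n ν σ ν^≤ σ^≤
           (≤-trans |H|≤ (collect ν 0<ν κ ((suc κ * γ) ^ suc k) (ν ^ (suc k + suc k)) (n * σ))))
     , distances
    where
    open ≤-Reasoning
    e : ∀ n k x v z → 2 * ((n * k) * (x * v * z)) ≡ 2 * (k * x) * (n * v * z)
    e = solve-∀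
    collect : ∀ ν → 0 < ν → ∀ κ x v z → 2 * (suc (ν * κ) * (x * v * z)) ≤ 2 * (suc κ * x) * (ν * v * z)
    collect ν 0<ν κ x v z = begin
      2 * (suc (ν * κ) * (x * v * z))      ≤⟨ *-monoʳ-≤ 2 (*-monoˡ-≤ (x * v * z) (+-monoˡ-≤ (ν * κ) 0<ν)) ⟩
      2 * ((ν + ν * κ) * (x * v * z))      ≡⟨ cong (λ y → 2 * (y * (x * v * z))) (sym (*-suc ν κ)) ⟩
      2 * (ν * suc κ * (x * v * z))        ≡⟨ e ν (suc κ) x v z ⟩
      2 * (suc κ * x) * (ν * v * z)        ∎

theorem1p1 : (δ : ℝ) → 0ℚᵘ <ᴿ δ →
    (k : ℕ) .{{_ : NonZero k}} → 2 ≤ k →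
    ∃ λ (C : ℕ) → ∃ λ (A : ℕ) →
    ∀ (n : ℕ) (G : Graph n) →
    ∃ λ (H : Graph n) →
    (H ⊆ G)
    × (∣E H ∣ ≤[ A · n ^ℝ 1+[1+ δ ]/[2^[1+ k ]∸1] ])
    × (∀ s t d → Dist G s t d →
    ∃ λ d′ → Dist H s t d′ × (d′ ≤ d +[ C · d ^ℚ 1ℚᵘ - + 1 / k ]))
theorem1p1 δ 0<δ (suc k) _ with Equivalence.to (lower-rounded δ 0ℚᵘ) 0<δ
-- Roundedness supplies a rational strictly between 0 and `δ`; its denominator D+1 enters `κ`.
... | mkℚᵘ z D , 0<l , l<δ with positive-numerator 0<l
...   | m , refl = stretch-constant δ k l<δ , size-constant δ k l<δ , λ n G →
  let H , H⊆G , |H|≤ , distances = spanner-exists δ k l<δ n G in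
  H , H⊆G , |H|≤ , λ s t d dist →
  let d′ , dist′ , d′≤ = distances s t d dist in
  -- The unnormalised rational 1 - 1/(k+1) computes to numerator `k + 0` and denominator
  -- `suc (k + 0)`.
  d′ , dist′ , subst (λ j → (d′ ∸ d) ^ suc j ≤ stretch-constant δ k l<δ ^ suc j * d ^ j) (sym (+-identityʳ k)) d′≤
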